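{- Let $r \geq 4$ be an integer and define $t$ by: $t=r$ if $r \equiv 0 \pmod 4$; $t=r-1$ if $r \equiv 1 \pmod 2$; $t=r-2$ if $r \equiv 2 \pmod 4$. Then there are infinitely many $t$-edge-connected $r$-graphs which do not contain $r-2$ pairwise disjoint $1$-factors.
   Context: All graphs are finite and may have parallel edges but no loops. A graph is $r$-regular if every vertex has degree $r$. For $S \subseteq V(G)$, $\partial_G(S)$ denotes the set of edges with exactly one end in $S$. An $r$-graph is an $r$-regular graph $G$ such that $|\partial_G(S)| \geq r$ for every $S \subseteq V(G)$ with $|S|$ odd. A $1$-factor is a spanning $1$-regular subgraph (its edge set is a perfect matching); $1$-factors are pairwise disjoint if their edge sets are pairwise disjoint (parallel edges count as distinct edges). -}

module Defs where

open import Data.Nat using (ℕ; zero; suc; _≤_; _∸_; _%_)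
open import Data.Bool using (Bool; true; false; _∨_; _xor_)
open import Data.Fin using (Fin; _≟_)
open import Data.Fin.Subset using (Subset; ∣_∣; _∈_; _∩_)
open import Data.Vec using (tabulate; lookup)
open import Data.Product using (_×_; proj₁; proj₂; Σ)
open import Data.Empty using (⊥)
open import Relation.Nullary using (¬_; ⌊_⌋)
open import Relation.Binary.PropositionalEquality using (_≡_; _≢_)

-- A finite multigraph without loops: vertices Fin nV, edges Fin nE
-- (distinct indices = distinct edges, so parallel edges are allowed).
record Graph : Set where
  field
    nV     : ℕ
    nE     : ℕ
    ends   : Fin nE → Fin nV × Fin nV
    noLoop : ∀ e → proj₁ (ends e) ≢ proj₂ (ends e)

open Graph public

incident : (G : Graph) → Fin (nV G) → Fin (nE G) → Bool
incident G v e = ⌊ proj₁ (ends G e) ≟ v ⌋ ∨ ⌊ proj₂ (ends G e) ≟ v ⌋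

incEdges : (G : Graph) → Fin (nV G) → Subset (nE G)
incEdges G v = tabulate (incident G v)

degree : (G : Graph) → Fin (nV G) → ℕ
degree G v = ∣ incEdges G v ∣

IsRegular : ℕ → Graph → Set
IsRegular r G = ∀ v → degree G v ≡ r

boundary : (G : Graph) → Subset (nV G) → Subset (nE G)
boundary G S = tabulate (λ e → lookup S (proj₁ (ends G e)) xor lookup S (proj₂ (ends G e)))

IsRGraph : ℕ → Graph → Set
IsRGraph r G = IsRegular r G ×
  ((S : Subset (nV G)) → ∣ S ∣ % 2 ≡ 1 → r ≤ ∣ boundary G S ∣)

IsEdgeConnected : ℕ → Graph → Set
IsEdgeConnected t G = (S : Subset (nV G)) → 1 ≤ ∣ S ∣ → suc ∣ S ∣ ≤ nV G →
  t ≤ ∣ boundary G S ∣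

IsOneFactor : (G : Graph) → Subset (nE G) → Set
IsOneFactor G M = ∀ v → ∣ M ∩ incEdges G v ∣ ≡ 1

HasDisjointOneFactors : ℕ → Graph → Set
HasDisjointOneFactors k G = Σ (Fin k → Subset (nE G)) λ F →
  ((i : Fin k) → IsOneFactor G (F i)) ×
  ((i j : Fin k) → i ≢ j → (e : Fin (nE G)) → e ∈ F i → e ∈ F j → ⊥)

tOf : ℕ → ℕ
tOf r with r % 4
... | 0 = r
... | 2 = r ∸ 2
... | _ = r ∸ 1

{-# OPTIONS --safe #-}
module Submission where

-- Write P for the Petersen graph and N₀, …, N₅ for its perfect matchings; an edge of P lies in exactly two of them, and
-- any two share exactly one edge, so the edges of P are the pairs {i, j}.  Put q = t / 2, so r is 2q, 2q + 1 or 2q + 2.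
--
-- Let P(c, a) be P with edge {i, j} replaced by c + aᵢ + aⱼ parallel edges.  A family of r − 2 disjoint perfect matchings
-- of P(c, a), of which nᵢ project to Nᵢ, uses nᵢ + nⱼ of them.  Integrality gives: if xᵢ + xⱼ ≤ 1 + yᵢ + yⱼ for all
-- pairs among at least three indices, then ∑ x ≤ 1 + ∑ y.
--
-- * In the gadget P(1, β), where 3 + ∑ β = r and 1 + β₀ + β₁ = q, this forces all but at most one of the q edges of
--   class {0, 1} to be used by any r − 2 disjoint perfect matchings.
-- * Choose q edges at a vertex v of an r-graph G and q edges of class {0, 1} of the gadget, at its vertex w, and exchange
--   the ends v and w of these edges.  This keeps the cut conditions, and perfect matchings of the result restrict to
--   perfect matchings of both graphs using equally many of the chosen edges.  So now any r − 2 disjoint perfect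
--   matchings leave at most one of the chosen edges of G unused.
-- * Start from P(0, α) with ∑ α = r and αᵢ + αⱼ ≤ q, and do this for each edge class.  Then αᵢ + αⱼ ≤ 1 + nᵢ + nⱼ for
--   all pairs, so r = ∑ α ≤ 1 + ∑ n = r − 1.  Inserting further gadgets gives arbitrarily large graphs.

open import Defs
open import Data.Bool using (Bool; true; false; _∧_; _∨_; _xor_; not; if_then_else_)
open import Data.Bool.Properties as Bool using (xor-same; ∧-zeroʳ; ∧-identityʳ; ¬-not)
open import Data.Fin using (Fin; zero; suc; _≟_; _↑ˡ_; _↑ʳ_; splitAt; punchIn)
open import Data.Fin.Patterns
open import Data.Fin.Properties as Fin using
  (splitAt-↑ˡ; splitAt-↑ʳ; splitAt⁻¹-↑ˡ; splitAt⁻¹-↑ʳ; ↑ˡ-injective; ↑ʳ-injective; punchIn-injective; toℕ<n; any?; all?)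
open import Data.Fin.Subset using (Subset; ∣_∣; _∩_; ∁)
open import Data.Fin.Subset.Properties using (anySubset?; nonempty?; Empty-unique; ∣⊥∣≡0; ∣p∣≤n; ∣∁p∣≡n∸∣p∣)
open import Data.Maybe using (Maybe; just; nothing; maybe′)
open import Data.Nat as ℕ using (ℕ; zero; suc; _+_; _*_; _∸_; _≤_; _<_; z≤n; s≤s; _%_; _/_; _≤?_)
open import Data.Nat.DivMod using (m*n%n≡0; [m+kn]%n≡m%n; m≡m%n+[m/n]*n; m%n<n)
open import Data.Nat.Properties hiding (_≟_; _≤?_; suc-injective)
open import Data.Nat.Solver using (module +-*-Solver)
open import Data.Product using (Σ; ∃; _×_; _,_; proj₁; proj₂)
open import Data.Sum using (_⊎_; inj₁; inj₂; [_,_]′)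
open import Data.Vec using (Vec; []; _∷_; lookup; tabulate)
open import Data.Vec.Functional using () renaming (_∷_ to _◂_)
open import Data.Vec.Properties using (lookup∘tabulate; lookup-zipWith; lookup-map; lookup⇒[]=; []=⇒lookup)
open import Function using (_∘_; _⇔_; mk⇔)
open import Relation.Binary.PropositionalEquality
open import Relation.Nullary using (¬_; Dec; yes; no; ⌊_⌋; contradiction)
open import Relation.Nullary.Decidable using
  (¬?; _→-dec_; _×-dec_; _⊎-dec_; decidable-stable; from-yes; from-no; isYes≗does; does-⇔)
open import Algebra.Properties.Semiring.Sum +-*-semiring using
  (sum; sum-cong-≗; sum-remove; sum-replicate-zero; ∑-distrib-+; ∑-comm; *-distribˡ-sum)

private variable
  m n : ℕ

-- Sums and cardinalities

-- Opaque, so that unification can read the summand off a sum.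
opaque
  ∑ : (Fin n → ℕ) → ℕ
  ∑ = sum

  ∑-suc : (f : Fin (suc n) → ℕ) → ∑ f ≡ f zero + ∑ (f ∘ suc)
  ∑-suc f = refl

  ∑-cong : {f g : Fin n → ℕ} → (∀ i → f i ≡ g i) → ∑ f ≡ ∑ g
  ∑-cong = sum-cong-≗

  ∑-mono : {f g : Fin n → ℕ} → (∀ i → f i ≤ g i) → ∑ f ≤ ∑ g
  ∑-mono {zero}  f≤g = z≤n
  ∑-mono {suc n} f≤g = +-mono-≤ (f≤g zero) (∑-mono (f≤g ∘ suc))

  ∑-zero : ∀ n → ∑ {n} (λ _ → 0) ≡ 0
  ∑-zero = sum-replicate-zero

  ∑-+ : (f g : Fin n → ℕ) → ∑ (λ i → f i + g i) ≡ ∑ f + ∑ g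
  ∑-+ = ∑-distrib-+

  ∑-* : ∀ c (f : Fin n → ℕ) → ∑ (λ i → c * f i) ≡ c * ∑ f
  ∑-* c f = sym (*-distribˡ-sum c f)

  ∑-swap : (f : Fin m → Fin n → ℕ) → ∑ (λ i → ∑ (λ j → f i j)) ≡ ∑ (λ j → ∑ (λ i → f i j))
  ∑-swap = ∑-comm

  ∑-↑ : ∀ m {n} (f : Fin (m + n) → ℕ) →
        ∑ f ≡ ∑ (λ i → f (i ↑ˡ n)) + ∑ (λ i → f (m ↑ʳ i))
  ∑-↑ zero    f = refl
  ∑-↑ (suc m) f = trans (cong (f zero +_) (∑-↑ m (f ∘ suc))) (sym (+-assoc (f zero) _ _))

𝟙 : Bool → ℕ
𝟙 false = 0
𝟙 true  = 1

𝟙≤1 : ∀ b → 𝟙 b ≤ 1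
𝟙≤1 false = z≤n
𝟙≤1 true  = ≤-refl

# : (Fin n → Bool) → ℕ
# f = ∑ (λ i → 𝟙 (f i))

#-cong : {f g : Fin n → Bool} → (∀ i → f i ≡ g i) → # f ≡ # g
#-cong f≡g = ∑-cong (λ i → cong 𝟙 (f≡g i))

opaque
  unfolding ∑

  ∣tabulate∣ : (f : Fin n → Bool) → ∣ tabulate f ∣ ≡ # f
  ∣tabulate∣ {zero}  f = refl
  ∣tabulate∣ {suc n} f with f zero
  ... | true  = cong suc (∣tabulate∣ (f ∘ suc))
  ... | false = ∣tabulate∣ (f ∘ suc)

  ∣_∣≡#lookup : (p : Subset n) → ∣ p ∣ ≡ # (lookup p)
  ∣ []        ∣≡#lookup = refl
  ∣ true ∷ p  ∣≡#lookup = cong suc ∣ p ∣≡#lookup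
  ∣ false ∷ p ∣≡#lookup = ∣ p ∣≡#lookup

⌊⌋-⇔ : ∀ {a b} {A : Set a} {B : Set b} → A ⇔ B → (a? : Dec A) (b? : Dec B) → ⌊ a? ⌋ ≡ ⌊ b? ⌋
⌊⌋-⇔ A⇔B a? b? = trans (isYes≗does a?) (trans (does-⇔ A⇔B a? b?) (sym (isYes≗does b?)))

⌊⌋-no : ∀ {a} {A : Set a} → ¬ A → (a? : Dec A) → ⌊ a? ⌋ ≡ false
⌊⌋-no ¬a (yes a) = contradiction a ¬a
⌊⌋-no ¬a (no _)  = refl

↑ˡ≢↑ʳ : {i : Fin m} {j : Fin n} → i ↑ˡ n ≢ m ↑ʳ j
↑ˡ≢↑ʳ {i = i} {j} eq
  with () ← trans (sym (splitAt-↑ˡ _ i _)) (trans (cong (splitAt _) eq) (splitAt-↑ʳ _ _ j))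

⌊x≟x⌋ : (x : Fin n) → 𝟙 ⌊ x ≟ x ⌋ ≡ 1
⌊x≟x⌋ x with x ≟ x
... | yes _  = refl
... | no x≢x = contradiction refl x≢x

⌊⌋-suc : (i j : Fin n) → ⌊ suc i ≟ suc j ⌋ ≡ ⌊ i ≟ j ⌋
⌊⌋-suc i j = ⌊⌋-⇔ (mk⇔ Fin.suc-injective (cong suc)) (suc i ≟ suc j) (i ≟ j)

opaque
  unfolding ∑

  ∑-one : ∀ n → ∑ {n} (λ _ → 1) ≡ n
  ∑-one zero    = refl
  ∑-one (suc n) = cong suc (∑-one n)

  ∑-δ : (j : Fin n) (f : Fin n → ℕ) → ∑ (λ i → 𝟙 ⌊ i ≟ j ⌋ * f i) ≡ f j
  ∑-δ {suc n} zero f =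
    trans (cong₂ _+_ (+-identityʳ (f zero)) (∑-zero n)) (+-identityʳ (f zero))
  ∑-δ {suc n} (suc j) f =
    trans (∑-cong (λ i → cong (λ b → 𝟙 b * f (suc i)) (⌊⌋-suc i j))) (∑-δ j (f ∘ suc))

↑-elim : ∀ {p} (Q : Fin (m + n) → Set p) → (∀ i → Q (i ↑ˡ n)) → (∀ j → Q (m ↑ʳ j)) → ∀ x → Q x
↑-elim {m} Q ql qr x with splitAt m x in eq
... | inj₁ i = subst Q (splitAt⁻¹-↑ˡ eq) (ql i)
... | inj₂ j = subst Q (splitAt⁻¹-↑ʳ eq) (qr j)

separated? : (s : Fin n → Bool) (v : Fin n) →
  (∃ λ x → ∃ λ y → s x ≡ true × s y ≡ false) ⊎ (∀ x → s x ≡ s v)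
separated? s v with any? (λ x → ¬? (s x Bool.≟ s v))
... | no ∄x = inj₂ λ x → decidable-stable (s x Bool.≟ s v) λ sx≢sv → ∄x (x , sx≢sv)
... | yes (x , sx≢sv) with s x in p | s v in p′
...   | true  | true  = contradiction refl sx≢sv
...   | true  | false = inj₁ (x , v , p , p′)
...   | false | true  = inj₁ (v , x , p′ , p)
...   | false | false = contradiction refl sx≢sv

odd-summand : ∀ a b → (a + b) % 2 ≡ 1 → a % 2 ≡ 1 ⊎ b % 2 ≡ 1
odd-summand zero          b p = inj₂ p
odd-summand (suc zero)    b p = inj₁ refl
odd-summand (suc (suc a)) b p = odd-summand a b p

double : ∀ a → 2 * a ≡ a + a + 0
double a = trans (cong (a +_) (+-identityʳ a)) (sym (+-identityʳ (a + a)))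

double+1 : ∀ a → a + a + 1 ≡ suc (2 * a)
double+1 a = trans (+-comm (a + a) 1) (cong (λ b → suc (a + b)) (sym (+-identityʳ a)))

-- Serves to compare how many exchanged edges a factor uses on the two sides of a splice: both
-- counts are at most 1, so their parity determines them.
same-parity : ∀ h t {a b} → a ≤ 1 → b ≤ 1 → h + h + a ≡ t + t + b → a ≡ b
same-parity h t {0} {0} _ _ eq = refl
same-parity h t {1} {1} _ _ eq = refl
same-parity h t {0} {1} _ _ eq = contradiction (trans (double h) (trans eq (double+1 t))) (even≢odd h t)
same-parity h t {1} {0} _ _ eq = contradiction (trans (double t) (trans (sym eq) (double+1 h))) (even≢odd t h)
same-parity h t {suc (suc _)} (s≤s ()) _ eq
same-parity h t {_} {suc (suc _)} _ (s≤s ()) eq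

≤-+-trans : ∀ d a b c → d ≤ a + c → c ≤ b → d ≤ a + b
≤-+-trans d a b c d≤a+c c≤b = ≤-trans d≤a+c (+-monoʳ-≤ a c≤b)

-- The equation is the degree balance at an exchange vertex: the coefficients 1 are the values of
-- the indicator of that vertex, `d` is a degree within one graph and `b` counts some of those `d`
-- edges.
cancel-used : ∀ a b d → 1 + 1 * b ≡ d + 1 * a → b ≤ d → a ≤ 1
cancel-used a b d eq b≤d = +-cancelˡ-≤ b a 1 (begin
  b + a     ≤⟨ +-monoˡ-≤ a b≤d ⟩
  d + a     ≡⟨ cong (d +_) (*-identityˡ a) ⟨
  d + 1 * a ≡⟨ eq ⟨
  1 + 1 * b ≡⟨ cong (1 +_) (*-identityˡ b) ⟩
  1 + b     ≡⟨ +-comm 1 b ⟩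
  b + 1 ∎)
  where open ≤-Reasoning

-- Cuts, matching degrees and the invariant of the construction

cut : (G : Graph) → (Fin (nV G) → Bool) → ℕ
cut G s = # λ e → s (proj₁ (ends G e)) xor s (proj₂ (ends G e))

mdeg : (G : Graph) → (Fin (nE G) → Bool) → Fin (nV G) → ℕ
mdeg G M v = # λ e → M e ∧ incident G v e

cut-const : ∀ G s {b} → (∀ x → s x ≡ b) → cut G s ≡ 0
cut-const G s {b} s≡b = trans (#-cong (λ e → trans (cong₂ _xor_ (s≡b _) (s≡b _)) (xor-same b))) (∑-zero _)

∧-∨-split : ∀ k {a b x : Fin n} → a ≢ b →
  𝟙 (k ∧ (⌊ a ≟ x ⌋ ∨ ⌊ b ≟ x ⌋)) ≡ 𝟙 ⌊ x ≟ a ⌋ * 𝟙 k + 𝟙 ⌊ x ≟ b ⌋ * 𝟙 k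
∧-∨-split k {a} {b} {x} a≢b with a ≟ x | x ≟ a | b ≟ x | x ≟ b
∧-∨-split k     a≢b | yes refl | _        | yes refl | _        = contradiction refl a≢b
∧-∨-split k     a≢b | yes refl | _        | _        | yes refl = contradiction refl a≢b
∧-∨-split k     a≢b | yes refl | no a≢a   | _        | _        = contradiction refl a≢a
∧-∨-split k     a≢b | no a≢x   | yes refl | _        | _        = contradiction refl a≢x
∧-∨-split k     a≢b | _        | _        | yes refl | no b≢b   = contradiction refl b≢b
∧-∨-split k     a≢b | _        | _        | no b≢x   | yes refl = contradiction refl b≢x
∧-∨-split true  a≢b | yes refl | yes refl | no _     | no _     = refl
∧-∨-split false a≢b | yes refl | yes refl | no _     | no _     = refl
∧-∨-split true  a≢b | no _     | no _     | yes refl | yes refl = refl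
∧-∨-split false a≢b | no _     | no _     | yes refl | yes refl = refl
∧-∨-split true  a≢b | no _     | no _     | no _     | no _     = refl
∧-∨-split false a≢b | no _     | no _     | no _     | no _     = refl

handshake : ∀ G M → ∑ (mdeg G M) ≡ # M + # M
handshake G M = begin
  ∑ (λ x → ∑ (λ e → 𝟙 (M e ∧ incident G x e)))
    ≡⟨ ∑-swap _ ⟩
  ∑ (λ e → ∑ (λ x → 𝟙 (M e ∧ incident G x e)))
    ≡⟨ ∑-cong (λ e → trans (∑-cong (λ x → ∧-∨-split (M e) (noLoop G e))) (∑-+ _ _)) ⟩
  ∑ (λ e → ∑ (λ x → 𝟙 ⌊ x ≟ proj₁ (ends G e) ⌋ * 𝟙 (M e)) + ∑ (λ x → 𝟙 ⌊ x ≟ proj₂ (ends G e) ⌋ * 𝟙 (M e)))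
    ≡⟨ ∑-cong (λ e → cong₂ _+_ (∑-δ (proj₁ (ends G e)) _) (∑-δ (proj₂ (ends G e)) _)) ⟩
  ∑ (λ e → 𝟙 (M e) + 𝟙 (M e))
    ≡⟨ ∑-+ _ _ ⟩
  # M + # M ∎
  where open ≡-Reasoning

-- The 2q-edge-connected r-graphs, with vertex sets as boolean functions; a set is nonempty and
-- proper because `x` lies inside and `y` outside.
record Good (r q : ℕ) (G : Graph) : Set where
  field
    regular   : ∀ v → # (incident G v) ≡ r
    oddCut    : ∀ s → # s % 2 ≡ 1 → r ≤ cut G s
    connected : ∀ s x y → s x ≡ true → s y ≡ false → q + q ≤ cut G s

-- Disjointness is a count at each edge, so that it can be summed over sets of edges.
record Packing (k : ℕ) (G : Graph) : Set where
  field
    factor    : Fin k → Fin (nE G) → Bool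
    isFactor  : ∀ i v → mdeg G (factor i) v ≡ 1
    packed    : ∀ e → # (λ i → factor i e) ≤ 1

open Good
open Packing

-- Splicing two graphs

-- nothing stands for the vertex of the other graph that receives the edge.
relocate : Bool → Fin n → Fin n → Maybe (Fin n)
relocate l v a = if l ∧ ⌊ a ≟ v ⌋ then nothing else just a

hit : Fin n → Maybe (Fin n) → Bool
hit x = maybe′ (λ a → ⌊ a ≟ x ⌋) false

gone : Maybe (Fin n) → Bool
gone = maybe′ (λ _ → false) true

relocate-stays : ∀ (s : Fin n → Bool) l v a → maybe′ s (s v) (relocate l v a) ≡ s a
relocate-stays s false v a = refl
relocate-stays s true  v a with a ≟ v
... | yes refl = refl
... | no _     = refl

-- An edge of the exchanged set has exactly one end at `v`. Moving that end to the opposite side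
-- toggles whether the edge crosses, so an indicator c becomes 1 - c, and (1 - c) + 2c = c + 1. The
-- additive form avoids truncated subtraction.
relocate-otherSide : ∀ (s : Fin n → Bool) l v a b → a ≢ b →
  (l ≡ true → ⌊ a ≟ v ⌋ ∨ ⌊ b ≟ v ⌋ ≡ true) →
  𝟙 (maybe′ s (not (s v)) (relocate l v a) xor maybe′ s (not (s v)) (relocate l v b))
    + (𝟙 (l ∧ (s a xor s b)) + 𝟙 (l ∧ (s a xor s b)))
  ≡ 𝟙 (s a xor s b) + 𝟙 l
relocate-otherSide s false v a b a≢b inc = refl
relocate-otherSide s true  v a b a≢b inc with a ≟ v | b ≟ v | inc refl
... | yes refl | yes refl | _ = contradiction refl a≢b
... | yes refl | no _     | _ with s a | s b
...   | false | false = refl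
...   | false | true  = refl
...   | true  | false = refl
...   | true  | true  = refl
relocate-otherSide s true v a b a≢b inc | no _ | yes refl | _ with s a | s b
...   | false | false = refl
...   | false | true  = refl
...   | true  | false = refl
...   | true  | true  = refl

gone-relocate : ∀ l (v a b : Fin n) → (l ≡ true → ⌊ a ≟ v ⌋ ∨ ⌊ b ≟ v ⌋ ≡ true) →
  gone (relocate l v a) ∨ gone (relocate l v b) ≡ l
gone-relocate false v a b inc = refl
gone-relocate true  v a b inc with a ≟ v | b ≟ v | inc refl
... | yes _ | _     | _ = refl
... | no _  | yes _ | _ = refl

-- Relocation destroys only incidences of exchanged edges with `v`, and the second summand restores
-- them. The boolean `k` is membership in a matching.
hit-relocate : ∀ (x : Fin n) k l v a b → a ≢ b →
  (l ≡ true → ⌊ a ≟ v ⌋ ∨ ⌊ b ≟ v ⌋ ≡ true) →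
  𝟙 (k ∧ (hit x (relocate l v a) ∨ hit x (relocate l v b))) + 𝟙 (⌊ x ≟ v ⌋ ∧ (k ∧ l))
  ≡ 𝟙 (k ∧ (⌊ a ≟ x ⌋ ∨ ⌊ b ≟ x ⌋))
hit-relocate x false l v a b a≢b inc with ⌊ x ≟ v ⌋
... | true  = refl
... | false = refl
hit-relocate x true false v a b a≢b inc rewrite ∧-zeroʳ ⌊ x ≟ v ⌋ = +-identityʳ _
hit-relocate x true true v a b a≢b inc with a ≟ v | b ≟ v | inc refl
... | yes refl | yes refl | _ = contradiction refl a≢b
... | yes refl | no _     | _ with x ≟ a | a ≟ x | b ≟ x
...   | yes refl | yes _    | yes refl = contradiction refl a≢b
...   | yes refl | yes _    | no _     = refl
...   | yes refl | no a≢a   | _        = contradiction refl a≢a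
...   | no x≢a   | yes refl | _        = contradiction refl x≢a
...   | no _     | no _     | _        = +-identityʳ _
hit-relocate x true true v a b a≢b inc | no _ | yes refl | _ with x ≟ b | b ≟ x | a ≟ x
...   | yes refl | yes _    | yes refl = contradiction refl a≢b
...   | yes refl | yes _    | no _     = refl
...   | yes refl | no b≢b   | _        = contradiction refl b≢b
...   | no x≢b   | yes refl | _        = contradiction refl x≢b
...   | no _     | no _     | yes _    = refl
...   | no _     | no _     | no _     = refl

relocate-noLoop : (f : Fin m → Fin n) (y : Fin n) → (∀ {a b} → f a ≡ f b → a ≡ b) → (∀ {a} → f a ≢ y) →
  ∀ l v a b → a ≢ b → maybe′ f y (relocate l v a) ≢ maybe′ f y (relocate l v b)
relocate-noLoop f y inj f≢y false v a b a≢b eq = a≢b (inj eq)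
relocate-noLoop f y inj f≢y true  v a b a≢b eq with a ≟ v | b ≟ v
... | yes refl | yes refl = a≢b refl
... | yes refl | no _     = f≢y (sym eq)
... | no _     | yes refl = f≢y eq
... | no _     | no _     = a≢b (inj eq)

module Side (G : Graph) (v : Fin (nV G)) (L : Fin (nE G) → Bool)
            (L-inc : ∀ e → L e ≡ true → incident G v e ≡ true) where

  end₁ end₂ : Fin (nE G) → Maybe (Fin (nV G))
  end₁ e = relocate (L e) v (proj₁ (ends G e))
  end₂ e = relocate (L e) v (proj₂ (ends G e))

  -- The share of this graph in a cut of the splice; `t` is the side of the foreign vertex that
  -- receives the edges of `L`.
  sideCut : (Fin (nV G) → Bool) → Bool → ℕ
  sideCut s t = # λ e → maybe′ s t (end₁ e) xor maybe′ s t (end₂ e)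

  sideCut-same : ∀ s → sideCut s (s v) ≡ cut G s
  sideCut-same s = #-cong λ e → cong₂ _xor_ (relocate-stays s (L e) v _) (relocate-stays s (L e) v _)

  private
    crossing : (Fin (nV G) → Bool) → ℕ
    crossing s = # λ e → L e ∧ (s (proj₁ (ends G e)) xor s (proj₂ (ends G e)))

  sideCut-other : ∀ s → sideCut s (not (s v)) + (crossing s + crossing s) ≡ cut G s + # L
  sideCut-other s = begin
    sideCut s (not (s v)) + (crossing s + crossing s)
      ≡⟨ cong (sideCut s (not (s v)) +_) (∑-+ _ _) ⟨
    sideCut s (not (s v)) + ∑ (λ e → 𝟙 (c e) + 𝟙 (c e))
      ≡⟨ ∑-+ _ _ ⟨
    ∑ (λ e → 𝟙 (maybe′ s (not (s v)) (end₁ e) xor maybe′ s (not (s v)) (end₂ e)) + (𝟙 (c e) + 𝟙 (c e)))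
      ≡⟨ ∑-cong (λ e → relocate-otherSide s (L e) v _ _ (noLoop G e) (L-inc e)) ⟩
    ∑ (λ e → 𝟙 (s (proj₁ (ends G e)) xor s (proj₂ (ends G e))) + 𝟙 (L e))
      ≡⟨ ∑-+ _ _ ⟩
    cut G s + # L ∎
    where
    open ≡-Reasoning
    c : Fin (nE G) → Bool
    c e = L e ∧ (s (proj₁ (ends G e)) xor s (proj₂ (ends G e)))

  crossing≤L : ∀ s → crossing s ≤ # L
  crossing≤L s = ∑-mono λ e → ∧-≤ˡ (L e) _
    where
    ∧-≤ˡ : ∀ a b → 𝟙 (a ∧ b) ≤ 𝟙 a
    ∧-≤ˡ false b = z≤n
    ∧-≤ˡ true  b = 𝟙≤1 b

  crossing≤cut : ∀ s → crossing s ≤ cut G s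
  crossing≤cut s = ∑-mono λ e → ∧-≤ʳ (L e) _
    where
    ∧-≤ʳ : ∀ a b → 𝟙 (a ∧ b) ≤ 𝟙 b
    ∧-≤ʳ false b = z≤n
    ∧-≤ʳ true  b = ≤-refl

  -- Toggling removes at most the edges of `L` from the cut.
  cut≤sideCut+L : ∀ s → cut G s ≤ sideCut s (not (s v)) + # L
  cut≤sideCut+L s = +-cancelʳ-≤ (# L) _ _ (begin
    cut G s + # L                                     ≡⟨ sideCut-other s ⟨
    sideCut s (not (s v)) + (crossing s + crossing s) ≤⟨ +-monoʳ-≤ (sideCut s (not (s v))) (+-mono-≤ (crossing≤L s) (crossing≤L s)) ⟩
    sideCut s (not (s v)) + (# L + # L)               ≡⟨ +-assoc (sideCut s (not (s v))) _ _ ⟨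
    sideCut s (not (s v)) + # L + # L ∎)
    where open ≤-Reasoning

  -- No edge of `L` crosses beforehand, so all of them are toggled into the cut.
  sideCut-trivial : ∀ s → cut G s ≡ 0 → sideCut s (not (s v)) ≡ # L
  sideCut-trivial s d≡0 = begin
    sideCut s (not (s v))                             ≡⟨ +-identityʳ _ ⟨
    sideCut s (not (s v)) + 0                         ≡⟨ cong (λ c → sideCut s (not (s v)) + (c + c)) crossing≡0 ⟨
    sideCut s (not (s v)) + (crossing s + crossing s) ≡⟨ sideCut-other s ⟩
    cut G s + # L                                     ≡⟨ cong (_+ # L) d≡0 ⟩
    # L ∎
    where
    open ≡-Reasoning
    crossing≡0 : crossing s ≡ 0
    crossing≡0 = n≤0⇒n≡0 (subst (crossing s ≤_) d≡0 (crossing≤cut s))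

  used : (Fin (nE G) → Bool) → ℕ
  used M = # λ e → M e ∧ L e

  sideDeg : (Fin (nE G) → Bool) → Fin (nV G) → ℕ
  sideDeg M x = # λ e → M e ∧ (hit x (end₁ e) ∨ hit x (end₂ e))

  sum-δ : ∀ (x : Fin (nV G)) (f : Fin n → Bool) → # (λ e → ⌊ x ≟ v ⌋ ∧ f e) ≡ 𝟙 ⌊ x ≟ v ⌋ * # f
  sum-δ x f with ⌊ x ≟ v ⌋
  ... | true  = sym (+-identityʳ _)
  ... | false = ∑-zero _

  sideDeg-mdeg : ∀ M x → sideDeg M x + 𝟙 ⌊ x ≟ v ⌋ * used M ≡ mdeg G M x
  sideDeg-mdeg M x = begin
    sideDeg M x + 𝟙 ⌊ x ≟ v ⌋ * used M                       ≡⟨ cong (sideDeg M x +_) (sum-δ x (λ e → M e ∧ L e)) ⟨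
    sideDeg M x + # (λ e → ⌊ x ≟ v ⌋ ∧ (M e ∧ L e))          ≡⟨ ∑-+ _ _ ⟨
    ∑ (λ e → 𝟙 (M e ∧ (hit x (end₁ e) ∨ hit x (end₂ e))) + 𝟙 (⌊ x ≟ v ⌋ ∧ (M e ∧ L e)))
      ≡⟨ ∑-cong (λ e → hit-relocate x (M e) (L e) v _ _ (noLoop G e) (L-inc e)) ⟩
    mdeg G M x ∎
    where open ≡-Reasoning

  used≤mdeg : ∀ M → used M ≤ mdeg G M v
  used≤mdeg M = begin
    used M                               ≡⟨ *-identityˡ (used M) ⟨
    1 * used M                           ≡⟨ cong (_* used M) (⌊x≟x⌋ v) ⟨
    𝟙 ⌊ v ≟ v ⌋ * used M                 ≤⟨ m≤n+m _ (sideDeg M v) ⟩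
    sideDeg M v + 𝟙 ⌊ v ≟ v ⌋ * used M   ≡⟨ sideDeg-mdeg M v ⟩
    mdeg G M v ∎
    where open ≤-Reasoning

module _ (G H : Graph) (v : Fin (nV G)) (w : Fin (nV H))
         (L : Fin (nE G) → Bool) (K : Fin (nE H) → Bool) where

  private
    placeˡ : Maybe (Fin (nV G)) → Fin (nV G + nV H)
    placeˡ = maybe′ (_↑ˡ nV H) (nV G ↑ʳ w)

    placeʳ : Maybe (Fin (nV H)) → Fin (nV G + nV H)
    placeʳ = maybe′ (nV G ↑ʳ_) (v ↑ˡ nV H)

    endsˡ : Fin (nE G) → Fin (nV G + nV H) × Fin (nV G + nV H)
    endsˡ e = placeˡ (relocate (L e) v (proj₁ (ends G e))) , placeˡ (relocate (L e) v (proj₂ (ends G e)))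

    endsʳ : Fin (nE H) → Fin (nV G + nV H) × Fin (nV G + nV H)
    endsʳ e = placeʳ (relocate (K e) w (proj₁ (ends H e))) , placeʳ (relocate (K e) w (proj₂ (ends H e)))

  -- The disjoint union of G and H, except that the edges of L end at w instead of v, and those of K at v instead of w.
  splice : Graph
  splice = record
    { nV     = nV G + nV H
    ; nE     = nE G + nE H
    ; ends   = λ e → [ endsˡ , endsʳ ]′ (splitAt (nE G) e)
    ; noLoop = λ e → nl (splitAt (nE G) e)
    }
    where
    nl : ∀ e → proj₁ ([ endsˡ , endsʳ ]′ e) ≢ proj₂ ([ endsˡ , endsʳ ]′ e)
    nl (inj₁ e) = relocate-noLoop (_↑ˡ nV H) _ (↑ˡ-injective (nV H) _ _) ↑ˡ≢↑ʳ (L e) v _ _ (noLoop G e)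
    nl (inj₂ e) = relocate-noLoop (nV G ↑ʳ_) _ (↑ʳ-injective (nV G) _ _) (↑ˡ≢↑ʳ ∘ sym) (K e) w _ _ (noLoop H e)

  ends-ˡ : ∀ e → ends splice (e ↑ˡ nE H) ≡ endsˡ e
  ends-ˡ e = cong [ endsˡ , endsʳ ]′ (splitAt-↑ˡ (nE G) e (nE H))

  ends-ʳ : ∀ e → ends splice (nE G ↑ʳ e) ≡ endsʳ e
  ends-ʳ e = cong [ endsˡ , endsʳ ]′ (splitAt-↑ʳ (nE G) (nE H) e)

  private
    ˡ≟ˡ : ∀ m x → ⌊ placeˡ m ≟ x ↑ˡ nV H ⌋ ≡ hit x m
    ˡ≟ˡ (just a) x = ⌊⌋-⇔ (mk⇔ (↑ˡ-injective (nV H) a x) (cong (_↑ˡ nV H))) _ _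
    ˡ≟ˡ nothing  x = ⌊⌋-no (↑ˡ≢↑ʳ ∘ sym) _

    ʳ≟ʳ : ∀ m x → ⌊ placeʳ m ≟ nV G ↑ʳ x ⌋ ≡ hit x m
    ʳ≟ʳ (just a) x = ⌊⌋-⇔ (mk⇔ (↑ʳ-injective (nV G) a x) (cong (nV G ↑ʳ_))) _ _
    ʳ≟ʳ nothing  x = ⌊⌋-no ↑ˡ≢↑ʳ _

    ʳ≟ˡ : ∀ m x → ⌊ placeʳ m ≟ x ↑ˡ nV H ⌋ ≡ ⌊ x ≟ v ⌋ ∧ gone m
    ʳ≟ˡ (just a) x = trans (⌊⌋-no (↑ˡ≢↑ʳ ∘ sym) _) (sym (∧-zeroʳ _))
    ʳ≟ˡ nothing  x = trans (⌊⌋-⇔ (mk⇔ (λ eq → sym (↑ˡ-injective (nV H) v x eq)) (λ { refl → refl })) _ _) (sym (∧-identityʳ _))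

    ˡ≟ʳ : ∀ m x → ⌊ placeˡ m ≟ nV G ↑ʳ x ⌋ ≡ ⌊ x ≟ w ⌋ ∧ gone m
    ˡ≟ʳ (just a) x = trans (⌊⌋-no ↑ˡ≢↑ʳ _) (sym (∧-zeroʳ _))
    ˡ≟ʳ nothing  x = trans (⌊⌋-⇔ (mk⇔ (λ eq → sym (↑ʳ-injective (nV G) w x eq)) (λ { refl → refl })) _ _) (sym (∧-identityʳ _))

  module Spliced (L-inc : ∀ e → L e ≡ true → incident G v e ≡ true)
                 (K-inc : ∀ e → K e ≡ true → incident H w e ≡ true) where

    module ˡ = Side G v L L-inc
    module ʳ = Side H w K K-inc

    incident-ˡˡ : ∀ x e → incident splice (x ↑ˡ nV H) (e ↑ˡ nE H) ≡ hit x (ˡ.end₁ e) ∨ hit x (ˡ.end₂ e)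
    incident-ˡˡ x e rewrite ends-ˡ e = cong₂ _∨_ (ˡ≟ˡ (ˡ.end₁ e) x) (ˡ≟ˡ (ˡ.end₂ e) x)

    incident-ʳʳ : ∀ x e → incident splice (nV G ↑ʳ x) (nE G ↑ʳ e) ≡ hit x (ʳ.end₁ e) ∨ hit x (ʳ.end₂ e)
    incident-ʳʳ x e rewrite ends-ʳ e = cong₂ _∨_ (ʳ≟ʳ (ʳ.end₁ e) x) (ʳ≟ʳ (ʳ.end₂ e) x)

    private
      ∧-∨ : ∀ a b c d → b ∨ c ≡ d → (a ∧ b) ∨ (a ∧ c) ≡ a ∧ d
      ∧-∨ true  b c d eq = eq
      ∧-∨ false b c d eq = refl

    incident-ˡʳ : ∀ x e → incident splice (x ↑ˡ nV H) (nE G ↑ʳ e) ≡ ⌊ x ≟ v ⌋ ∧ K e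
    incident-ˡʳ x e rewrite ends-ʳ e =
      trans (cong₂ _∨_ (ʳ≟ˡ (ʳ.end₁ e) x) (ʳ≟ˡ (ʳ.end₂ e) x)) (∧-∨ ⌊ x ≟ v ⌋ _ _ _ (gone-relocate (K e) w (proj₁ (ends H e)) (proj₂ (ends H e)) (K-inc e)))

    incident-ʳˡ : ∀ x e → incident splice (nV G ↑ʳ x) (e ↑ˡ nE H) ≡ ⌊ x ≟ w ⌋ ∧ L e
    incident-ʳˡ x e rewrite ends-ˡ e =
      trans (cong₂ _∨_ (ˡ≟ʳ (ˡ.end₁ e) x) (ˡ≟ʳ (ˡ.end₂ e) x)) (∧-∨ ⌊ x ≟ w ⌋ _ _ _ (gone-relocate (L e) v (proj₁ (ends G e)) (proj₂ (ends G e)) (L-inc e)))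

    cut-splice : ∀ s → let s₁ = λ x → s (x ↑ˡ nV H); s₂ = λ x → s (nV G ↑ʳ x) in
      cut splice s ≡ ˡ.sideCut s₁ (s₂ w) + ʳ.sideCut s₂ (s₁ v)
    cut-splice s = trans (∑-↑ (nE G) _) (cong₂ _+_ (#-cong eqˡ) (#-cong eqʳ))
      where
      s₁ = λ x → s (x ↑ˡ nV H)
      s₂ = λ x → s (nV G ↑ʳ x)
      pˡ : ∀ m → s (placeˡ m) ≡ maybe′ s₁ (s₂ w) m
      pˡ (just _) = refl
      pˡ nothing  = refl
      pʳ : ∀ m → s (placeʳ m) ≡ maybe′ s₂ (s₁ v) m
      pʳ (just _) = refl
      pʳ nothing  = refl
      eqˡ : ∀ e → s (proj₁ (ends splice (e ↑ˡ nE H))) xor s (proj₂ (ends splice (e ↑ˡ nE H)))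
                ≡ maybe′ s₁ (s₂ w) (ˡ.end₁ e) xor maybe′ s₁ (s₂ w) (ˡ.end₂ e)
      eqˡ e rewrite ends-ˡ e = cong₂ _xor_ (pˡ (ˡ.end₁ e)) (pˡ (ˡ.end₂ e))
      eqʳ : ∀ e → s (proj₁ (ends splice (nE G ↑ʳ e))) xor s (proj₂ (ends splice (nE G ↑ʳ e)))
                ≡ maybe′ s₂ (s₁ v) (ʳ.end₁ e) xor maybe′ s₂ (s₁ v) (ʳ.end₂ e)
      eqʳ e rewrite ends-ʳ e = cong₂ _xor_ (pʳ (ʳ.end₁ e)) (pʳ (ʳ.end₂ e))

    module _ (M : Fin (nE G + nE H) → Bool) where

      private
        M₁ = λ e → M (e ↑ˡ nE H)
        M₂ = λ e → M (nE G ↑ʳ e)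

        ∧-swap : ∀ a b c → a ∧ (b ∧ c) ≡ b ∧ (a ∧ c)
        ∧-swap true  b c = refl
        ∧-swap false b c = sym (∧-zeroʳ b)

      -- At `v` the splice trades the edges of `L` for those of `K`; elsewhere in `G` degrees are
      -- unchanged. Each set is added on the opposite side of the equation instead of being
      -- subtracted.
      mdeg-ˡ : ∀ x → mdeg splice M (x ↑ˡ nV H) + 𝟙 ⌊ x ≟ v ⌋ * ˡ.used M₁ ≡ mdeg G M₁ x + 𝟙 ⌊ x ≟ v ⌋ * ʳ.used M₂
      mdeg-ˡ x = begin
        mdeg splice M (x ↑ˡ nV H) + δ * ˡ.used M₁          ≡⟨ cong (_+ δ * ˡ.used M₁) (∑-↑ (nE G) _) ⟩
        # (λ e → M₁ e ∧ _) + # (λ e → M₂ e ∧ _) + δ * ˡ.used M₁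
          ≡⟨ cong₂ (λ a b → a + b + δ * ˡ.used M₁)
               (#-cong (λ e → cong (M₁ e ∧_) (incident-ˡˡ x e)))
               (#-cong (λ e → trans (cong (M₂ e ∧_) (incident-ˡʳ x e)) (∧-swap (M₂ e) ⌊ x ≟ v ⌋ (K e)))) ⟩
        ˡ.sideDeg M₁ x + # (λ e → ⌊ x ≟ v ⌋ ∧ (M₂ e ∧ K e)) + δ * ˡ.used M₁
          ≡⟨ cong (λ b → ˡ.sideDeg M₁ x + b + δ * ˡ.used M₁) (ˡ.sum-δ x (λ e → M₂ e ∧ K e)) ⟩
        ˡ.sideDeg M₁ x + δ * ʳ.used M₂ + δ * ˡ.used M₁     ≡⟨ swapʳ (ˡ.sideDeg M₁ x) _ _ ⟩
        ˡ.sideDeg M₁ x + δ * ˡ.used M₁ + δ * ʳ.used M₂     ≡⟨ cong (_+ δ * ʳ.used M₂) (ˡ.sideDeg-mdeg M₁ x) ⟩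
        mdeg G M₁ x + δ * ʳ.used M₂ ∎
        where
        open ≡-Reasoning
        δ = 𝟙 ⌊ x ≟ v ⌋
        swapʳ : ∀ a b c → a + b + c ≡ a + c + b
        swapʳ a b c = trans (+-assoc a b c) (trans (cong (a +_) (+-comm b c)) (sym (+-assoc a c b)))

      mdeg-ʳ : ∀ x → mdeg splice M (nV G ↑ʳ x) + 𝟙 ⌊ x ≟ w ⌋ * ʳ.used M₂ ≡ mdeg H M₂ x + 𝟙 ⌊ x ≟ w ⌋ * ˡ.used M₁
      mdeg-ʳ x = begin
        mdeg splice M (nV G ↑ʳ x) + δ * ʳ.used M₂          ≡⟨ cong (_+ δ * ʳ.used M₂) (∑-↑ (nE G) _) ⟩
        # (λ e → M₁ e ∧ _) + # (λ e → M₂ e ∧ _) + δ * ʳ.used M₂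
          ≡⟨ cong₂ (λ a b → a + b + δ * ʳ.used M₂)
               (#-cong (λ e → trans (cong (M₁ e ∧_) (incident-ʳˡ x e)) (∧-swap (M₁ e) ⌊ x ≟ w ⌋ (L e))))
               (#-cong (λ e → cong (M₂ e ∧_) (incident-ʳʳ x e))) ⟩
        # (λ e → ⌊ x ≟ w ⌋ ∧ (M₁ e ∧ L e)) + ʳ.sideDeg M₂ x + δ * ʳ.used M₂
          ≡⟨ cong (λ b → b + ʳ.sideDeg M₂ x + δ * ʳ.used M₂) (ʳ.sum-δ x (λ e → M₁ e ∧ L e)) ⟩
        δ * ˡ.used M₁ + ʳ.sideDeg M₂ x + δ * ʳ.used M₂     ≡⟨ +-assoc (δ * ˡ.used M₁) _ _ ⟩
        δ * ˡ.used M₁ + (ʳ.sideDeg M₂ x + δ * ʳ.used M₂)   ≡⟨ +-comm (δ * ˡ.used M₁) _ ⟩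
        ʳ.sideDeg M₂ x + δ * ʳ.used M₂ + δ * ˡ.used M₁     ≡⟨ cong (_+ δ * ˡ.used M₁) (ʳ.sideDeg-mdeg M₂ x) ⟩
        mdeg H M₂ x + δ * ˡ.used M₁ ∎
        where
        open ≡-Reasoning
        δ = 𝟙 ⌊ x ≟ w ⌋

    private
      all : Fin n → Bool
      all _ = true

    -- Degrees persist because the exchanged sets have equal size. A cut of the splice is at least
    -- as large as each of the cuts it induces on `G` and `H`. An odd set is odd on one side; and if
    -- both induced cuts are trivial but the splice cut is not, exactly the 2q exchanged edges
    -- cross.
    splice-good : ∀ {r q} → Good r q G → Good r q H → # L ≡ q → # K ≡ q → Good r q splice
    splice-good {r} {q} gG gH #L≡q #K≡q = record
      { regular = ↑-elim _ regˡ regʳ ; oddCut = odd ; connected = conn }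
      where
      regˡ : ∀ x → # (incident splice (x ↑ˡ nV H)) ≡ r
      regˡ x = +-cancelʳ-≡ (𝟙 ⌊ x ≟ v ⌋ * q) _ _ (begin
        mdeg splice all (x ↑ˡ nV H) + 𝟙 ⌊ x ≟ v ⌋ * q   ≡⟨ cong (λ c → mdeg splice all (x ↑ˡ nV H) + 𝟙 ⌊ x ≟ v ⌋ * c) #L≡q ⟨
        mdeg splice all (x ↑ˡ nV H) + 𝟙 ⌊ x ≟ v ⌋ * # L ≡⟨ mdeg-ˡ all x ⟩
        mdeg G all x + 𝟙 ⌊ x ≟ v ⌋ * # K                ≡⟨ cong₂ (λ d c → d + 𝟙 ⌊ x ≟ v ⌋ * c) (regular gG x) #K≡q ⟩
        r + 𝟙 ⌊ x ≟ v ⌋ * q ∎)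
        where open ≡-Reasoning
      regʳ : ∀ x → # (incident splice (nV G ↑ʳ x)) ≡ r
      regʳ x = +-cancelʳ-≡ (𝟙 ⌊ x ≟ w ⌋ * q) _ _ (begin
        mdeg splice all (nV G ↑ʳ x) + 𝟙 ⌊ x ≟ w ⌋ * q   ≡⟨ cong (λ c → mdeg splice all (nV G ↑ʳ x) + 𝟙 ⌊ x ≟ w ⌋ * c) #K≡q ⟨
        mdeg splice all (nV G ↑ʳ x) + 𝟙 ⌊ x ≟ w ⌋ * # K ≡⟨ mdeg-ʳ all x ⟩
        mdeg H all x + 𝟙 ⌊ x ≟ w ⌋ * # L                ≡⟨ cong₂ (λ d c → d + 𝟙 ⌊ x ≟ w ⌋ * c) (regular gH x) #L≡q ⟩
        r + 𝟙 ⌊ x ≟ w ⌋ * q ∎)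
        where open ≡-Reasoning

      module _ (s : Fin (nV G + nV H) → Bool) where
        s₁ = λ x → s (x ↑ˡ nV H)
        s₂ = λ x → s (nV G ↑ʳ x)
        d₁ = cut G s₁
        d₂ = cut H s₂

        cut-agree : s₁ v ≡ s₂ w → cut splice s ≡ d₁ + d₂
        cut-agree eq = trans (cut-splice s) (cong₂ _+_
          (trans (cong (ˡ.sideCut s₁) (sym eq)) (ˡ.sideCut-same s₁))
          (trans (cong (ʳ.sideCut s₂) eq) (ʳ.sideCut-same s₂)))

        cut-differ : s₁ v ≢ s₂ w → cut splice s ≡ ˡ.sideCut s₁ (not (s₁ v)) + ʳ.sideCut s₂ (not (s₂ w))
        cut-differ neq = trans (cut-splice s) (cong₂ _+_
          (cong (ˡ.sideCut s₁) (¬-not (neq ∘ sym)))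
          (cong (ʳ.sideCut s₂) (¬-not neq)))

        bothTrivial : s₁ v ≢ s₂ w → d₁ ≡ 0 → d₂ ≡ 0 → cut splice s ≡ q + q
        bothTrivial neq d₁≡0 d₂≡0 = trans (cut-differ neq) (cong₂ _+_
          (trans (ˡ.sideCut-trivial s₁ d₁≡0) #L≡q) (trans (ʳ.sideCut-trivial s₂ d₂≡0) #K≡q))

        large⊎trivial₁ : (q + q ≤ d₁) ⊎ (∀ x → s₁ x ≡ s₁ v)
        large⊎trivial₁ with separated? s₁ v
        ... | inj₁ (x , y , p , p′) = inj₁ (connected gG s₁ x y p p′)
        ... | inj₂ p = inj₂ p

        large⊎trivial₂ : (q + q ≤ d₂) ⊎ (∀ x → s₂ x ≡ s₂ w)
        large⊎trivial₂ with separated? s₂ w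
        ... | inj₁ (x , y , p , p′) = inj₁ (connected gH s₂ x y p p′)
        ... | inj₂ p = inj₂ p

        d₁≤ : d₁ ≤ cut splice s
        d₁≤ with s₁ v Bool.≟ s₂ w
        ... | yes eq = subst (d₁ ≤_) (sym (cut-agree eq)) (m≤m+n d₁ d₂)
        -- With `v` and `w` separated, the part of `G` loses at most q edges and the part of `H`
        -- supplies at least q: either d₂ ≥ 2q, of which at most q are lost, or `s₂` is constant and
        -- all q edges of `K` cross.
        ... | no neq = subst (d₁ ≤_) (sym (cut-differ neq)) (≤-+-trans d₁ _ _ q
                (subst (λ c → d₁ ≤ ˡ.sideCut s₁ (not (s₁ v)) + c) #L≡q (ˡ.cut≤sideCut+L s₁)) q≤)
          where
          q≤ : q ≤ ʳ.sideCut s₂ (not (s₂ w))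
          q≤ with large⊎trivial₂
          ... | inj₁ big = +-cancelʳ-≤ q _ _ (≤-trans big (subst (λ c → d₂ ≤ ʳ.sideCut s₂ (not (s₂ w)) + c) #K≡q (ʳ.cut≤sideCut+L s₂)))
          ... | inj₂ c   = ≤-reflexive (sym (trans (ʳ.sideCut-trivial s₂ (cut-const H s₂ c)) #K≡q))

        d₂≤ : d₂ ≤ cut splice s
        d₂≤ with s₁ v Bool.≟ s₂ w
        ... | yes eq = subst (d₂ ≤_) (sym (cut-agree eq)) (m≤n+m d₂ d₁)
        ... | no neq = subst (d₂ ≤_) (trans (+-comm (ʳ.sideCut s₂ _) _) (sym (cut-differ neq))) (≤-+-trans d₂ _ _ q
                (subst (λ c → d₂ ≤ ʳ.sideCut s₂ (not (s₂ w)) + c) #K≡q (ʳ.cut≤sideCut+L s₂)) q≤)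
          where
          q≤ : q ≤ ˡ.sideCut s₁ (not (s₁ v))
          q≤ with large⊎trivial₁
          ... | inj₁ big = +-cancelʳ-≤ q _ _ (≤-trans big (subst (λ c → d₁ ≤ ˡ.sideCut s₁ (not (s₁ v)) + c) #L≡q (ˡ.cut≤sideCut+L s₁)))
          ... | inj₂ c   = ≤-reflexive (sym (trans (ˡ.sideCut-trivial s₁ (cut-const G s₁ c)) #L≡q))

      odd : ∀ s → # s % 2 ≡ 1 → r ≤ cut splice s
      odd s p with odd-summand (# (s₁ s)) (# (s₂ s)) (trans (cong (_% 2) (sym (∑-↑ (nV G) _))) p)
      ... | inj₁ p₁ = ≤-trans (oddCut gG (s₁ s) p₁) (d₁≤ s)
      ... | inj₂ p₂ = ≤-trans (oddCut gH (s₂ s) p₂) (d₂≤ s)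

      conn : ∀ s x y → s x ≡ true → s y ≡ false → q + q ≤ cut splice s
      conn s x y sx sy with large⊎trivial₁ s | large⊎trivial₂ s
      ... | inj₁ big | _        = ≤-trans big (d₁≤ s)
      ... | inj₂ _   | inj₁ big = ≤-trans big (d₂≤ s)
      ... | inj₂ c₁  | inj₂ c₂ with s₁ s v Bool.≟ s₂ s w
      ...   | no neq = ≤-reflexive (sym (bothTrivial s neq (cut-const G _ c₁) (cut-const H _ c₂)))
      ...   | yes eq = contradiction (trans (sym sx) (trans (const x) (trans (sym (const y)) sy))) λ ()
        where
        const : ∀ z → s z ≡ s₁ s v
        const = ↑-elim _ c₁ (λ z → trans (c₂ z) (sym eq))

    module _ {k} (P : Packing k splice) where

      private
        M₁ : Fin k → Fin (nE G) → Bool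
        M₁ i e = factor P i (e ↑ˡ nE H)
        M₂ : Fin k → Fin (nE H) → Bool
        M₂ i e = factor P i (nE G ↑ʳ e)

        module _ (i : Fin k) where
          eqˡ : ∀ x → 1 + 𝟙 ⌊ x ≟ v ⌋ * ˡ.used (M₁ i) ≡ mdeg G (M₁ i) x + 𝟙 ⌊ x ≟ v ⌋ * ʳ.used (M₂ i)
          eqˡ x = trans (cong (_+ 𝟙 ⌊ x ≟ v ⌋ * ˡ.used (M₁ i)) (sym (isFactor P i (x ↑ˡ nV H)))) (mdeg-ˡ (factor P i) x)

          eqʳ : ∀ x → 1 + 𝟙 ⌊ x ≟ w ⌋ * ʳ.used (M₂ i) ≡ mdeg H (M₂ i) x + 𝟙 ⌊ x ≟ w ⌋ * ˡ.used (M₁ i)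
          eqʳ x = trans (cong (_+ 𝟙 ⌊ x ≟ w ⌋ * ʳ.used (M₂ i)) (sym (isFactor P i (nV G ↑ʳ x)))) (mdeg-ʳ (factor P i) x)

          -- In the splice the edges of `L` end at `w`, where a factor has a single edge; hence the
          -- balance at `w` is the one to use.
          usedˡ≤1 : ˡ.used (M₁ i) ≤ 1
          usedˡ≤1 = cancel-used _ _ (mdeg H (M₂ i) w)
            (subst (λ c → 1 + c * ʳ.used (M₂ i) ≡ mdeg H (M₂ i) w + c * ˡ.used (M₁ i)) (⌊x≟x⌋ w) (eqʳ w)) (ʳ.used≤mdeg (M₂ i))

          usedʳ≤1 : ʳ.used (M₂ i) ≤ 1
          usedʳ≤1 = cancel-used _ _ (mdeg G (M₁ i) v)
            (subst (λ c → 1 + c * ˡ.used (M₁ i) ≡ mdeg G (M₁ i) v + c * ʳ.used (M₂ i)) (⌊x≟x⌋ v) (eqˡ v)) (ˡ.used≤mdeg (M₁ i))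

          handshakes : nV H + ʳ.used (M₂ i) ≡ (# (M₂ i) + # (M₂ i)) + ˡ.used (M₁ i)
          handshakes = begin
            nV H + ʳ.used (M₂ i)                                    ≡⟨ cong₂ _+_ (∑-one (nV H)) (∑-δ w _) ⟨
            ∑ (λ x → 1) + ∑ (λ x → 𝟙 ⌊ x ≟ w ⌋ * ʳ.used (M₂ i))     ≡⟨ ∑-+ _ _ ⟨
            ∑ (λ x → 1 + 𝟙 ⌊ x ≟ w ⌋ * ʳ.used (M₂ i))               ≡⟨ ∑-cong eqʳ ⟩
            ∑ (λ x → mdeg H (M₂ i) x + 𝟙 ⌊ x ≟ w ⌋ * ˡ.used (M₁ i)) ≡⟨ ∑-+ _ _ ⟩
            ∑ (mdeg H (M₂ i)) + ∑ (λ x → 𝟙 ⌊ x ≟ w ⌋ * ˡ.used (M₁ i)) ≡⟨ cong₂ _+_ (handshake H (M₂ i)) (∑-δ w _) ⟩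
            (# (M₂ i) + # (M₂ i)) + ˡ.used (M₁ i) ∎
            where open ≡-Reasoning

      module _ {h} (even : nV H ≡ h + h) where

        -- Summing the degree balance over the even number of vertices of `H` shows that the two
        -- counts have the same parity, and both are at most 1. Once they agree, the correction
        -- terms cancel and both restrictions are perfect matchings.
        used-agree : ∀ i → ˡ.used (M₁ i) ≡ ʳ.used (M₂ i)
        used-agree i = sym (same-parity h (# (M₂ i)) (usedʳ≤1 i) (usedˡ≤1 i)
          (trans (cong (_+ ʳ.used (M₂ i)) (sym even)) (handshakes i)))

        splice-packingˡ : Packing k G
        splice-packingˡ = record
          { factor   = M₁
          ; isFactor = λ i x → +-cancelʳ-≡ (𝟙 ⌊ x ≟ v ⌋ * ʳ.used (M₂ i)) _ _
              (trans (sym (eqˡ i x)) (cong (λ c → 1 + 𝟙 ⌊ x ≟ v ⌋ * c) (used-agree i)))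
          ; packed   = λ e → packed P (e ↑ˡ nE H)
          }

        splice-packingʳ : Packing k H
        splice-packingʳ = record
          { factor   = M₂
          ; isFactor = λ i x → +-cancelʳ-≡ (𝟙 ⌊ x ≟ w ⌋ * ˡ.used (M₁ i)) _ _
              (trans (sym (eqʳ i x)) (cong (λ c → 1 + 𝟙 ⌊ x ≟ w ⌋ * c) (sym (used-agree i))))
          ; packed   = λ e → packed P (nE G ↑ʳ e)
          }

-- Edge sets nearly covered by a packing

coverage : ∀ {k G} → Packing k G → (Fin (nE G) → Bool) → ℕ
coverage P R = ∑ λ i → # λ e → factor P i e ∧ R e

Spared : ∀ {k G} → Packing k G → (Fin (nE G) → Bool) → Set
Spared P R = # R ≤ suc (coverage P R)

coverage≤# : ∀ {k G} (P : Packing k G) R → coverage P R ≤ # R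
coverage≤# P R = ≤-trans (≤-reflexive (∑-swap _)) (∑-mono λ e → step e (R e))
  where
  step : ∀ e b → ∑ (λ i → 𝟙 (factor P i e ∧ b)) ≤ 𝟙 b
  step e true  = ≤-trans (≤-reflexive (#-cong (λ i → ∧-identityʳ (factor P i e)))) (packed P e)
  step e false = ≤-reflexive (trans (#-cong (λ i → ∧-zeroʳ (factor P i e))) (∑-zero _))

_⊆_ : (R L : Fin n → Bool) → Set
R ⊆ L = ∀ i → R i ≡ true → L i ≡ true

spared-⊆ : ∀ {k G} (P : Packing k G) {R L} → R ⊆ L → Spared P L → Spared P R
spared-⊆ P {R} {L} R⊆L spared = +-cancelʳ-≤ (# D) _ _ (begin
  # R + # D                               ≡⟨ ∑-+ _ _ ⟨
  ∑ (λ e → 𝟙 (R e) + 𝟙 (D e))             ≡⟨ ∑-cong (λ e → split true (L e) (R e) (R⊆L e)) ⟨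
  # L                                     ≤⟨ spared ⟩
  suc (coverage P L)                      ≡⟨ cong suc (∑-cong λ i → trans
                                               (∑-cong λ e → split (factor P i e) (L e) (R e) (R⊆L e)) (∑-+ _ _)) ⟩
  suc (∑ (λ i → # (λ e → factor P i e ∧ R e) + # (λ e → factor P i e ∧ D e)))
                                          ≡⟨ cong suc (∑-+ _ _) ⟩
  suc (coverage P R) + coverage P D       ≤⟨ +-monoʳ-≤ (suc (coverage P R)) (coverage≤# P D) ⟩
  suc (coverage P R) + # D ∎)
  where
  open ≤-Reasoning
  D = λ e → L e ∧ not (R e)
  split : ∀ f l r → (r ≡ true → l ≡ true) → 𝟙 (f ∧ l) ≡ 𝟙 (f ∧ r) + 𝟙 (f ∧ (l ∧ not r))
  split false l     r     h = refl
  split true  true  true  h = refl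
  split true  true  false h = refl
  split true  false true  h = contradiction (h refl) λ ()
  split true  false false h = refl

opaque
  unfolding ∑

  #-between : ∀ {n} (R Y : Fin n → Bool) q → R ⊆ Y → # R ≤ q → q ≤ # Y →
    ∃ λ (L : Fin n → Bool) → R ⊆ L × L ⊆ Y × # L ≡ q
  #-between {zero}  R Y zero R⊆Y R≤q q≤Y = R , (λ ()) , (λ ()) , refl
  #-between {suc n} R Y q R⊆Y R≤q q≤Y with R zero in R₀ | Y zero in Y₀
  ... | true  | false = contradiction (trans (sym (R⊆Y zero R₀)) Y₀) λ ()
  ... | false | false =
    let L , R⊆L , L⊆Y , #L = #-between (R ∘ suc) (Y ∘ suc) q (R⊆Y ∘ suc) R≤q q≤Y
    in  (false ◂ L) , (λ { zero p → trans (sym R₀) p ; (suc i) → R⊆L i }) , (λ { zero () ; (suc i) → L⊆Y i }) , #L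
  #-between {suc n} R Y (suc q) R⊆Y (s≤s R≤q) (s≤s q≤Y) | true | true =
    let L , R⊆L , L⊆Y , #L = #-between (R ∘ suc) (Y ∘ suc) q (R⊆Y ∘ suc) R≤q q≤Y
    in  (true ◂ L) , (λ { zero p → refl ; (suc i) → R⊆L i }) , (λ { zero p → Y₀ ; (suc i) → L⊆Y i }) , cong suc #L
  #-between {suc n} R Y q R⊆Y R≤q q≤Y | false | true with q ≤? # (Y ∘ suc)
  ... | yes q≤Y′ =
    let L , R⊆L , L⊆Y , #L = #-between (R ∘ suc) (Y ∘ suc) q (R⊆Y ∘ suc) R≤q q≤Y′
    in  (false ◂ L) , (λ { zero p → trans (sym R₀) p ; (suc i) → R⊆L i }) , (λ { zero () ; (suc i) → L⊆Y i }) , #L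
  -- Without this element fewer than q remain, so `Y` has exactly q elements and is itself the set
  -- sought.
  ... | no q≰Y′ = Y , R⊆Y , (λ i p → p) ,
    trans (cong (λ b → 𝟙 b + # (Y ∘ suc)) Y₀) (≤-antisym (≰⇒> q≰Y′) q≤Y)

liftˡ : ∀ n → (Fin m → Bool) → Fin (m + n) → Bool
liftˡ {m} n R e = [ R , (λ _ → false) ]′ (splitAt m e)

liftˡ-ˡ : ∀ n (R : Fin m → Bool) e → liftˡ n R (e ↑ˡ n) ≡ R e
liftˡ-ˡ {m} n R e = cong [ R , (λ _ → false) ]′ (splitAt-↑ˡ m e n)

liftˡ-ʳ : ∀ n (R : Fin m → Bool) e → liftˡ n R (m ↑ʳ e) ≡ false
liftˡ-ʳ {m} n R e = cong [ R , (λ _ → false) ]′ (splitAt-↑ʳ m n e)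

#-∧-liftˡ : ∀ n (F : Fin (m + n) → Bool) (R : Fin m → Bool) →
  # (λ e → F e ∧ liftˡ n R e) ≡ # (λ e → F (e ↑ˡ n) ∧ R e)
#-∧-liftˡ {m} n F R = begin
  # (λ e → F e ∧ liftˡ n R e) ≡⟨ ∑-↑ m _ ⟩
  # (λ e → F (e ↑ˡ n) ∧ liftˡ n R (e ↑ˡ n)) + # (λ e → F (m ↑ʳ e) ∧ liftˡ n R (m ↑ʳ e))
    ≡⟨ cong₂ _+_ (#-cong λ e → cong (F (e ↑ˡ n) ∧_) (liftˡ-ˡ n R e))
                 (trans (#-cong λ e → trans (cong (F (m ↑ʳ e) ∧_) (liftˡ-ʳ n R e)) (∧-zeroʳ _)) (∑-zero n)) ⟩
  # (λ e → F (e ↑ˡ n) ∧ R e) + 0 ≡⟨ +-identityʳ _ ⟩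
  # (λ e → F (e ↑ˡ n) ∧ R e) ∎
  where open ≡-Reasoning

-- Absorbers and grafting

-- The even order feeds the parity argument of `used-agree`; the exact size q of the bundle keeps
-- the exchange balanced.
record Absorber (r q k : ℕ) : Set where
  field
    gadget     : Graph
    good       : Good r q gadget
    half       : ℕ
    even       : nV gadget ≡ half + half
    terminal   : Fin (nV gadget)
    bundle     : Fin (nE gadget) → Bool
    bundle-inc : bundle ⊆ incident gadget terminal
    bundle-size : # bundle ≡ q
    spared     : (P : Packing k gadget) → Spared P bundle

-- Two disjoint sets of edges at a vertex, each of which is to be spared.
record Demand (q : ℕ) (G : Graph) : Set where
  field
    vertex   : Fin (nV G)
    R₁ R₂    : Fin (nE G) → Bool
    inc₁     : R₁ ⊆ incident G vertex
    inc₂     : R₂ ⊆ incident G vertex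
    disjoint : ∀ e → R₁ e ≡ true → R₂ e ≡ false
    size₁    : # R₁ ≤ q
    size₂    : # R₂ ≤ q

module Grafting {r q k : ℕ} (2q≤r : q + q ≤ r) (A : Absorber r q k) where

  open Absorber A
  open Demand

  graft : (G : Graph) → Fin (nV G) → (Fin (nE G) → Bool) → Graph
  graft G v L = splice G gadget v terminal L bundle

  lift : (G : Graph) → (Fin (nE G) → Bool) → Fin (nE G + nE gadget) → Bool
  lift G = liftˡ (nE gadget)

  opaque
    -- At least 2q edges end at `v` and at most q of them lie in `X`, so at least q are available
    -- for padding `R`. The set `X` reserves edges for a later exchange at the same vertex.
    bundle-at : ∀ {G} → Good r q G → ∀ v R X → R ⊆ incident G v →
      (∀ e → R e ≡ true → X e ≡ false) → # R ≤ q → # X ≤ q →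
      ∃ λ L → R ⊆ L × L ⊆ incident G v × (∀ e → X e ≡ true → L e ≡ false) × # L ≡ q
    bundle-at {G} gG v R X R⊆inc R∩X R≤q X≤q =
      let L , R⊆L , L⊆Y , #L = #-between R Y q (λ e p → both (R⊆inc e p) (R∩X e p)) R≤q q≤Y
      in  L , R⊆L , (λ e p → proj₁ (unboth (L⊆Y e p))) , (λ e x → avoid (L e) (L⊆Y e) x) , #L
      where
      Y : Fin (nE G) → Bool
      Y e = incident G v e ∧ not (X e)
      both : ∀ {a b} → a ≡ true → b ≡ false → a ∧ not b ≡ true
      both refl refl = refl
      unboth : ∀ {a b} → a ∧ not b ≡ true → a ≡ true × b ≡ false
      unboth {true} {false} p = refl , refl
      avoid : ∀ {e} l → (l ≡ true → Y e ≡ true) → X e ≡ true → l ≡ false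
      avoid false _ _ = refl
      avoid {e} true h x = contradiction (trans (sym x) (proj₂ (unboth {incident G v e} (h refl)))) λ ()
      cover : ∀ a b → 𝟙 a ≤ 𝟙 (a ∧ not b) + 𝟙 b
      cover false b     = z≤n
      cover true  true  = ≤-refl
      cover true  false = ≤-refl
      q≤Y : q ≤ # Y
      q≤Y = +-cancelʳ-≤ q _ _ (begin
        q + q                    ≤⟨ 2q≤r ⟩
        r                        ≡⟨ regular gG v ⟨
        # (incident G v)         ≤⟨ ∑-mono (λ e → cover (incident G v e) (X e)) ⟩
        ∑ (λ e → 𝟙 (Y e) + 𝟙 (X e)) ≡⟨ ∑-+ _ _ ⟩
        # Y + # X                ≤⟨ +-monoʳ-≤ (# Y) X≤q ⟩
        # Y + q ∎)
        where open ≤-Reasoning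

  module _ (G : Graph) (v : Fin (nV G)) (L : Fin (nE G) → Bool) (L-inc : L ⊆ incident G v) where

    private
      G′ = graft G v L
      module S = Spliced G gadget v terminal L bundle L-inc bundle-inc

    opaque
      graft-good : Good r q G → # L ≡ q → Good r q G′
      graft-good gG #L≡q = S.splice-good gG good #L≡q bundle-size

      -- Factor by factor, `L` and the bundle are used equally often, and both have q edges, so `L`
      -- inherits being spared from the bundle. The last component carries sets spared by later
      -- grafts back to `G`.
      graft-project : # L ≡ q → (P : Packing k G′) →
        ∃ λ (P₀ : Packing k G) → Spared P₀ L × (∀ R → Spared P (lift G R) → Spared P₀ R)
      graft-project #L≡q P = P₀ , spared₀ , λ R → subst₂ (λ a b → a ≤ suc b)
          (#-∧-liftˡ (nE gadget) (λ _ → true) R) (∑-cong λ i → #-∧-liftˡ (nE gadget) (factor P i) R)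
        where
        P₀ : Packing k G
        P₀ = S.splice-packingˡ P {half} even
        spared₀ : Spared P₀ L
        spared₀ = begin
          # L                                                 ≡⟨ trans #L≡q (sym bundle-size) ⟩
          # bundle                                            ≤⟨ spared (S.splice-packingʳ P {half} even) ⟩
          suc (coverage (S.splice-packingʳ P {half} even) bundle)    ≡⟨ cong suc (∑-cong (S.used-agree P {half} even)) ⟨
          suc (coverage P₀ L) ∎
          where open ≤-Reasoning

      -- Only relocation could take an edge away from `x`, and it does so only for edges of `L` when
      -- `x` is `v`.
      graft-incident : ∀ x R → R ⊆ incident G x → (∀ e → R e ≡ true → ⌊ x ≟ v ⌋ ∧ L e ≡ false) →
        lift G R ⊆ incident G′ (x ↑ˡ nV gadget)
      graft-incident x R R⊆inc avoid = ↑-elim _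
        (λ e p → let Re = trans (sym (liftˡ-ˡ (nE gadget) R e)) p in
          trans (S.incident-ˡˡ x e) (𝟙-injective (begin
            𝟙 (hit x (S.ˡ.end₁ e) ∨ hit x (S.ˡ.end₂ e))         ≡⟨ +-identityʳ _ ⟨
            𝟙 (hit x (S.ˡ.end₁ e) ∨ hit x (S.ˡ.end₂ e)) + 0     ≡⟨ cong (λ b → 𝟙 (hit x (S.ˡ.end₁ e) ∨ hit x (S.ˡ.end₂ e)) + 𝟙 b) (avoid e Re) ⟨
            𝟙 (hit x (S.ˡ.end₁ e) ∨ hit x (S.ˡ.end₂ e)) + 𝟙 (⌊ x ≟ v ⌋ ∧ L e)
              ≡⟨ hit-relocate x true (L e) v _ _ (noLoop G e) (L-inc e) ⟩
            𝟙 (incident G x e)                                  ≡⟨ cong 𝟙 (R⊆inc e Re) ⟩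
            1 ∎)))
        (λ e p → contradiction (trans (sym p) (liftˡ-ʳ (nE gadget) R e)) λ ())
        where
        open ≡-Reasoning
        𝟙-injective : ∀ {b} → 𝟙 b ≡ 1 → b ≡ true
        𝟙-injective {true} _ = refl

    graft-demand : (d : Demand q G) → vertex d ≢ v → Demand q G′
    graft-demand d d≢v = record
      { vertex   = vertex d ↑ˡ nV gadget
      ; R₁       = lift G (R₁ d)
      ; R₂       = lift G (R₂ d)
      ; inc₁     = graft-incident (vertex d) (R₁ d) (inc₁ d) (λ e _ → cong (_∧ L e) (⌊⌋-no d≢v _))
      ; inc₂     = graft-incident (vertex d) (R₂ d) (inc₂ d) (λ e _ → cong (_∧ L e) (⌊⌋-no d≢v _))
      ; disjoint = ↑-elim _
          (λ e p → trans (liftˡ-ˡ (nE gadget) (R₂ d) e) (disjoint d e (trans (sym (liftˡ-ˡ (nE gadget) (R₁ d) e)) p)))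
          (λ e _ → liftˡ-ʳ (nE gadget) (R₂ d) e)
      ; size₁    = subst (_≤ q) (sym (#-∧-liftˡ (nE gadget) (λ _ → true) (R₁ d))) (size₁ d)
      ; size₂    = subst (_≤ q) (sym (#-∧-liftˡ (nE gadget) (λ _ → true) (R₂ d))) (size₂ d)
      }

  opaque
    -- Each demand takes two grafts at its vertex. The demands sit at distinct vertices, so the
    -- remaining ones survive both grafts, and the recursion continues with them; packings are then
    -- restricted back graph by graph.
    satisfy : ∀ n G → Good r q G → Fin (nV G) → (d : Fin n → Demand q G) →
      (∀ {i j} → vertex (d i) ≡ vertex (d j) → i ≡ j) →
      ∃ λ G′ → Good r q G′ × Fin (nV G′) ×
        (Packing k G′ → ∃ λ (P : Packing k G) → ∀ i → Spared P (R₁ (d i)) × Spared P (R₂ (d i)))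
    satisfy zero    G gG x d d-inj = G , gG , x , λ P → P , λ ()
    satisfy (suc n) G gG x d d-inj
      with bundle-at gG (vertex (d zero)) (R₁ (d zero)) (R₂ (d zero)) (inc₁ (d zero)) (disjoint (d zero)) (size₁ (d zero)) (size₂ (d zero))
    ... | L₁ , R₁⊆L₁ , L₁-inc , R₂∩L₁ , #L₁
      -- `L₁` avoids `R₂`, so the edges of `R₂` still end at this vertex. No further exchange at it
      -- follows, hence the empty reserved set.
      with bundle-at (graft-good G (vertex (d zero)) L₁ L₁-inc gG #L₁) (vertex (d zero) ↑ˡ nV gadget) (lift G (R₂ (d zero))) (λ _ → false)
            (graft-incident G (vertex (d zero)) L₁ L₁-inc (vertex (d zero)) (R₂ (d zero)) (inc₂ (d zero))
              (λ e p → trans (cong (⌊ vertex (d zero) ≟ vertex (d zero) ⌋ ∧_) (R₂∩L₁ e p)) (∧-zeroʳ _)))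
            (λ _ _ → refl)
            (subst (_≤ q) (sym (#-∧-liftˡ (nE gadget) (λ _ → true) (R₂ (d zero)))) (size₂ (d zero)))
            (≤-trans (≤-reflexive (∑-zero _)) z≤n)
    ... | L₂ , R₂⊆L₂ , L₂-inc , _ , #L₂
      with satisfy n (graft (graft G (vertex (d zero)) L₁) (vertex (d zero) ↑ˡ nV gadget) L₂)
            (graft-good _ _ L₂ L₂-inc (graft-good G (vertex (d zero)) L₁ L₁-inc gG #L₁) #L₂)
            ((x ↑ˡ nV gadget) ↑ˡ nV gadget)
            (λ i → graft-demand _ _ L₂ L₂-inc
              (graft-demand G (vertex (d zero)) L₁ L₁-inc (d (suc i)) (λ eq → contradiction (d-inj eq) λ ()))
              (λ eq → contradiction (d-inj (↑ˡ-injective (nV gadget) _ _ eq)) λ ()))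
            (λ eq → Fin.suc-injective (d-inj (↑ˡ-injective (nV gadget) _ _ (↑ˡ-injective (nV gadget) _ _ eq))))
    ... | G′ , gG′ , x′ , project = G′ , gG′ , x′ , combine
      where
      combine : Packing k G′ → ∃ λ (P : Packing k G) → ∀ i → Spared P (R₁ (d i)) × Spared P (R₂ (d i))
      combine P with project P
      ... | P₂ , sp₂ with graft-project _ _ L₂ L₂-inc #L₂ P₂
      ... | P₁ , sp-L₂ , down₁ with graft-project G (vertex (d zero)) L₁ L₁-inc #L₁ P₁
      ... | P₀ , sp-L₁ , down₀ = P₀ , λ
        -- The first set is spared in `P₀` directly; the second is spared in the intermediate
        -- packing `P₁` and carried down once.
        { zero    → spared-⊆ P₀ R₁⊆L₁ sp-L₁ , down₀ _ (spared-⊆ P₁ R₂⊆L₂ sp-L₂)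
        ; (suc i) → down₀ _ (down₁ _ (proj₁ (sp₂ i))) , down₀ _ (down₁ _ (proj₂ (sp₂ i)))
        }

    -- Any q edges at the current vertex serve for a graft: packings restrict to the smaller graph,
    -- and the gadget contributes at least its terminal as a new vertex.
    grow : ∀ N G → Good r q G → Fin (nV G) → ¬ Packing k G →
      ∃ λ G′ → Good r q G′ × Fin (nV G′) × ¬ Packing k G′ × N ≤ nV G′
    grow zero    G gG x ¬P = G , gG , x , ¬P , z≤n
    grow (suc N) G gG x ¬P with grow N G gG x ¬P
    ... | G′ , gG′ , x′ , ¬P′ , N≤
      with bundle-at gG′ x′ (λ _ → false) (λ _ → false) (λ _ ()) (λ _ _ → refl) ∅≤q ∅≤q
      where
      ∅≤q : ∀ {n} → # {n} (λ _ → false) ≤ q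
      ∅≤q = ≤-trans (≤-reflexive (∑-zero _)) z≤n
    ... | L , _ , L-inc , _ , #L =
         graft G′ x′ L , graft-good G′ x′ L L-inc gG′ #L , x′ ↑ˡ nV gadget ,
         (λ P → ¬P′ (proj₁ (graft-project G′ x′ L L-inc #L P))) ,
         ≤-trans (≤-reflexive (+-comm 1 N)) (+-mono-≤ N≤ (≤-trans (s≤s z≤n) (toℕ<n terminal)))

-- The integrality inequality

opaque
  unfolding ∑

  ∑-remove : (i : Fin (suc n)) (f : Fin (suc n) → ℕ) → ∑ f ≡ f i + ∑ (f ∘ punchIn i)
  ∑-remove i f = sum-remove {i = i} f

  ∑-const : ∀ n c → ∑ {n} (λ _ → c) ≡ n * c
  ∑-const zero    c = refl
  ∑-const (suc n) c = cong (c +_) (∑-const n c)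

  #≤1 : (f : Fin n → Bool) → (∀ i j → f i ≡ true → f j ≡ true → i ≡ j) → # f ≤ 1
  #≤1 {zero}  f unique = z≤n
  #≤1 {suc n} f unique with f zero in f₀
  ... | false = #≤1 (f ∘ suc) (λ i j p p′ → Fin.suc-injective (unique (suc i) (suc j) p p′))
  ... | true  = s≤s (≤-reflexive (trans (#-cong λ i → ¬-not λ fi → contradiction (unique zero (suc i) f₀ fi) λ ()) (∑-zero n)))

  ∑-triple : (x y : Fin 3 → ℕ) → (∀ i j → i ≢ j → x i + x j ≤ suc (y i + y j)) → ∑ x ≤ suc (∑ y)
  ∑-triple x y pair = ≮⇒≥ λ 1+∑y<∑x → <-irrefl refl (begin-strict
    ∑ x + ∑ x                                  ≡⟨ rearrange (x 0F) (x 1F) (x 2F) ⟩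
    (x 0F + x 1F) + (x 0F + x 2F) + (x 1F + x 2F)
      ≤⟨ +-mono-≤ (+-mono-≤ (pair 0F 1F λ ()) (pair 0F 2F λ ())) (pair 1F 2F λ ()) ⟩
    suc (y 0F + y 1F) + suc (y 0F + y 2F) + suc (y 1F + y 2F)
      <⟨ ≤-reflexive (rearrange′ (y 0F) (y 1F) (y 2F)) ⟩
    suc (suc (∑ y)) + suc (suc (∑ y))          ≤⟨ +-mono-≤ 1+∑y<∑x 1+∑y<∑x ⟩
    ∑ x + ∑ x ∎)
    where
    open ≤-Reasoning
    open +-*-Solver
    rearrange : ∀ a b c → (a + (b + (c + 0))) + (a + (b + (c + 0))) ≡ (a + b) + (a + c) + (b + c)
    rearrange = solve 3 (λ a b c → (a :+ (b :+ (c :+ con 0))) :+ (a :+ (b :+ (c :+ con 0)))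
                                    := (a :+ b) :+ (a :+ c) :+ (b :+ c)) refl
    rearrange′ : ∀ a b c → suc (suc (a + b) + suc (a + c) + suc (b + c))
                         ≡ suc (suc (a + (b + (c + 0)))) + suc (suc (a + (b + (c + 0))))
    rearrange′ = solve 3 (λ a b c → con 1 :+ ((con 1 :+ (a :+ b)) :+ (con 1 :+ (a :+ c)) :+ (con 1 :+ (b :+ c)))
                                     := (con 2 :+ (a :+ (b :+ (c :+ con 0)))) :+ (con 2 :+ (a :+ (b :+ (c :+ con 0))))) refl

-- With d = x − y: at most one of any two d's is positive, so a nonpositive one can be dropped until three are left;
-- for three, 2∑d ≤ 3 and integrality give ∑d ≤ 1.
∑-pairwise : ∀ n (x y : Fin (3 + n) → ℕ) → (∀ i j → i ≢ j → x i + x j ≤ suc (y i + y j)) → ∑ x ≤ suc (∑ y)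
∑-pairwise zero    x y pair = ∑-triple x y pair
∑-pairwise (suc n) x y pair = drop (nonpositive (x 0F ≤? y 0F) (x 1F ≤? y 1F))
  where
  nonpositive : Dec (x 0F ≤ y 0F) → Dec (x 1F ≤ y 1F) → ∃ λ i → x i ≤ y i
  nonpositive (yes p) _       = 0F , p
  nonpositive _       (yes p) = 1F , p
  nonpositive (no p)  (no p′) = contradiction (pair 0F 1F λ ()) (<⇒≱ (begin-strict
    suc (y 0F + y 1F)       <⟨ ≤-reflexive (cong suc (sym (+-suc (y 0F) (y 1F)))) ⟩
    suc (y 0F) + suc (y 1F) ≤⟨ +-mono-≤ (≰⇒> p) (≰⇒> p′) ⟩
    x 0F + x 1F ∎))
    where open ≤-Reasoning
  drop : (∃ λ i → x i ≤ y i) → ∑ x ≤ suc (∑ y)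
  drop (i , xi≤yi) = begin
    ∑ x                              ≡⟨ ∑-remove i x ⟩
    x i + ∑ (x ∘ punchIn i)          ≤⟨ +-mono-≤ xi≤yi (∑-pairwise n (x ∘ punchIn i) (y ∘ punchIn i)
                                          (λ j k j≢k → pair _ _ (j≢k ∘ punchIn-injective i j k))) ⟩
    y i + suc (∑ (y ∘ punchIn i))    ≡⟨ +-suc (y i) _ ⟩
    suc (y i + ∑ (y ∘ punchIn i))    ≡⟨ cong suc (∑-remove i y) ⟨
    suc (∑ y) ∎
    where open ≤-Reasoning

-- Replacing edges by classes of parallel edges

⌊≟⌋-sym : (i j : Fin n) → ⌊ i ≟ j ⌋ ≡ ⌊ j ≟ i ⌋
⌊≟⌋-sym i j = ⌊⌋-⇔ (mk⇔ sym sym) (i ≟ j) (j ≟ i)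

opaque
  unfolding ∑

  -- The copies of an edge form a block of consecutive indices, the blocks following the order of
  -- the edges.
  copyOf : (w : Fin n → ℕ) → Fin (∑ w) → Fin n
  copyOf {suc n} w x = [ (λ _ → zero) , (λ y → suc (copyOf (w ∘ suc) y)) ]′ (splitAt (w zero) x)

  ∑-copyOf : (w g : Fin n → ℕ) → ∑ (λ x → g (copyOf w x)) ≡ ∑ (λ e → w e * g e)
  ∑-copyOf {zero}  w g = refl
  ∑-copyOf {suc n} w g = trans (∑-↑ (w zero) (λ x → g (copyOf w x))) (cong₂ _+_
    (trans (∑-cong λ i → cong (g ∘ pick) (splitAt-↑ˡ (w zero) i _)) (∑-const (w zero) (g zero)))
    (trans (∑-cong λ i → cong (g ∘ pick) (splitAt-↑ʳ (w zero) _ i)) (∑-copyOf (w ∘ suc) (g ∘ suc))))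
    where
    pick : Fin (w zero) ⊎ Fin (∑ (w ∘ suc)) → Fin (suc n)
    pick = [ (λ _ → zero) , (λ y → suc (copyOf (w ∘ suc) y)) ]′

blowup : (B : Graph) → (Fin (nE B) → ℕ) → Graph
blowup B w = record
  { nV     = nV B
  ; nE     = ∑ w
  ; ends   = ends B ∘ copyOf w
  ; noLoop = noLoop B ∘ copyOf w
  }

class : (w : Fin n → ℕ) → Fin n → Fin (∑ w) → Bool
class w e x = ⌊ copyOf w x ≟ e ⌋

class-size : ∀ (w : Fin n → ℕ) e → # (class w e) ≡ w e
class-size w e = trans (∑-copyOf w (λ f → 𝟙 ⌊ f ≟ e ⌋))
  (trans (∑-cong λ f → *-comm (w f) _) (∑-δ e w))

class-incident : ∀ B w {v e} → incident B v e ≡ true → class w e ⊆ incident (blowup B w) v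
class-incident B w {v} {e} inc x p with copyOf w x ≟ e
... | yes eq = trans (cong (incident B v) eq) inc

class-disjoint : ∀ (w : Fin n → ℕ) {e f} → e ≢ f → ∀ x → class w e x ≡ true → class w f x ≡ false
class-disjoint w {e} {f} e≢f x p with copyOf w x ≟ e
... | yes refl = ⌊⌋-no e≢f _

mdeg-blowup : ∀ B w M v → mdeg (blowup B w) M v ≡ ∑ (λ e → 𝟙 (incident B v e) * # (λ x → M x ∧ class w e x))
mdeg-blowup B w M v = begin
  ∑ (λ x → 𝟙 (M x ∧ incident B v (copyOf w x)))
    ≡⟨ ∑-cong (λ x → ∑-δ (copyOf w x) (λ e → 𝟙 (M x ∧ incident B v e))) ⟨
  ∑ (λ x → ∑ (λ e → 𝟙 ⌊ e ≟ copyOf w x ⌋ * 𝟙 (M x ∧ incident B v e)))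
    ≡⟨ ∑-swap _ ⟩
  ∑ (λ e → ∑ (λ x → 𝟙 ⌊ e ≟ copyOf w x ⌋ * 𝟙 (M x ∧ incident B v e)))
    ≡⟨ ∑-cong (λ e → ∑-cong (λ x → trans
         (cong (λ b → 𝟙 b * 𝟙 (M x ∧ incident B v e)) (⌊≟⌋-sym e (copyOf w x)))
         (regroup (class w e x) (M x) (incident B v e)))) ⟩
  ∑ (λ e → ∑ (λ x → 𝟙 (incident B v e) * 𝟙 (M x ∧ class w e x)))
    ≡⟨ ∑-cong (λ e → ∑-* (𝟙 (incident B v e)) _) ⟩
  ∑ (λ e → 𝟙 (incident B v e) * # (λ x → M x ∧ class w e x)) ∎
  where
  open ≡-Reasoning
  regroup : ∀ c m i → 𝟙 c * 𝟙 (m ∧ i) ≡ 𝟙 i * 𝟙 (m ∧ c)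
  regroup false false i     = sym (*-zeroʳ (𝟙 i))
  regroup false true  i     = sym (*-zeroʳ (𝟙 i))
  regroup true  false i     = sym (*-zeroʳ (𝟙 i))
  regroup true  true  false = refl
  regroup true  true  true  = refl

-- The Petersen graph

petersenEnds : Vec (Fin 10 × Fin 10) 15
petersenEnds =
  (0F , 1F) ∷ (1F , 2F) ∷ (2F , 3F) ∷ (3F , 4F) ∷ (4F , 0F) ∷
  (0F , 5F) ∷ (1F , 6F) ∷ (2F , 7F) ∷ (3F , 8F) ∷ (4F , 9F) ∷
  (5F , 7F) ∷ (6F , 8F) ∷ (7F , 9F) ∷ (8F , 5F) ∷ (9F , 6F) ∷ []

opaque
  petersen-noLoop : ∀ e → proj₁ (lookup petersenEnds e) ≢ proj₂ (lookup petersenEnds e)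
  petersen-noLoop = from-yes (all? λ e → ¬? (proj₁ (lookup petersenEnds e) ≟ proj₂ (lookup petersenEnds e)))

petersen : Graph
petersen = record { nV = 10 ; nE = 15 ; ends = lookup petersenEnds ; noLoop = petersen-noLoop }

-- The Petersen graph has six perfect matchings, any two of which share exactly one edge; this identifies
-- its edges with the pairs of elements of Fin 6.
pairOf : Vec (Fin 6 × Fin 6) 15
pairOf =
  (3F , 5F) ∷ (1F , 4F) ∷ (2F , 5F) ∷ (1F , 3F) ∷ (2F , 4F) ∷
  (0F , 1F) ∷ (0F , 2F) ∷ (0F , 3F) ∷ (0F , 4F) ∷ (0F , 5F) ∷
  (4F , 5F) ∷ (1F , 5F) ∷ (1F , 2F) ∷ (2F , 3F) ∷ (3F , 4F) ∷ []

fst snd : Fin 15 → Fin 6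
fst e = proj₁ (lookup pairOf e)
snd e = proj₂ (lookup pairOf e)

-- As the two indices of an edge differ, this is the 0-1 indicator of e lying in the perfect
-- matching N_k.
star : Fin 15 → Fin 6 → ℕ
star e k = 𝟙 ⌊ k ≟ fst e ⌋ + 𝟙 ⌊ k ≟ snd e ⌋

outer spoke inner : Fin 5 → Fin 15
outer i = i ↑ˡ 10
spoke i = 5 ↑ʳ (i ↑ˡ 5)
inner i = 10 ↑ʳ i

edgesAt : Vec (Vec (Fin 15) 3) 10
edgesAt =
  (outer 0F ∷ outer 4F ∷ spoke 0F ∷ []) ∷ (outer 0F ∷ outer 1F ∷ spoke 1F ∷ []) ∷
  (outer 1F ∷ outer 2F ∷ spoke 2F ∷ []) ∷ (outer 2F ∷ outer 3F ∷ spoke 3F ∷ []) ∷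
  (outer 3F ∷ outer 4F ∷ spoke 4F ∷ []) ∷
  (spoke 0F ∷ inner 0F ∷ inner 3F ∷ []) ∷ (spoke 1F ∷ inner 1F ∷ inner 4F ∷ []) ∷
  (spoke 2F ∷ inner 0F ∷ inner 2F ∷ []) ∷ (spoke 3F ∷ inner 1F ∷ inner 3F ∷ []) ∷
  (spoke 4F ∷ inner 2F ∷ inner 4F ∷ []) ∷ []

-- The trailing zeros make ∑-at hold by computation.
sum₃ : (Fin 15 → ℕ) → Vec (Fin 15) 3 → ℕ
sum₃ f (a ∷ b ∷ c ∷ []) = (f a + 0) + ((f b + 0) + ((f c + 0) + 0))

crossings : (Fin 10 → Bool) → Fin 15 → ℕ
crossings s e = 𝟙 (s (proj₁ (ends petersen e)) xor s (proj₂ (ends petersen e)))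

starCut : (Fin 10 → Bool) → Fin 6 → ℕ
starCut s k = ∑ λ e → star e k * crossings s e

-- The term `2 * star e k` exempts the two matchings through `e`; all others meet the cut at least
-- twice.
OddCutBound EvenCutBound : (Fin 10 → Bool) → Set
OddCutBound s = # s % 2 ≡ 1 → 3 ≤ ∑ (crossings s) × (∀ k → 1 ≤ starCut s k)
EvenCutBound s = # s % 2 ≢ 1 → (∃ λ x → ∃ λ y → s x ≢ s y) →
  4 ≤ ∑ (crossings s) × ∃ λ e → ∀ k → 2 ≤ starCut s k + 2 * star e k

-- Stated through `edgesAt`, so that the exhaustive search evaluates three terms per vertex.
PerfectMatching : (Fin 15 → Bool) → Set
PerfectMatching s = ∀ v → sum₃ (𝟙 ∘ s) (lookup edgesAt v) ≡ 1

opaque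
  unfolding ∑

  ∑-at : ∀ v (f : Fin 15 → ℕ) → ∑ (λ e → 𝟙 (incident petersen v e) * f e) ≡ sum₃ f (lookup edgesAt v)
  ∑-at 0F f = refl
  ∑-at 1F f = refl
  ∑-at 2F f = refl
  ∑-at 3F f = refl
  ∑-at 4F f = refl
  ∑-at 5F f = refl
  ∑-at 6F f = refl
  ∑-at 7F f = refl
  ∑-at 8F f = refl
  ∑-at 9F f = refl

  petersen-cubic : ∀ v → # (incident petersen v) ≡ 3
  petersen-cubic = from-yes (all? λ v → # (incident petersen v) ℕ.≟ 3)

  star-perfect : ∀ v k → ∑ (λ e → star e k * 𝟙 (incident petersen v e)) ≡ 1
  star-perfect = from-yes (all? λ v → all? λ k → ∑ (λ e → star e k * 𝟙 (incident petersen v e)) ℕ.≟ 1)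

  -- Checked on all vertex sets. Behind it: the Petersen graph is 3-edge-connected, and by parity a
  -- perfect matching meets every odd cut.
  oddCutBound : (S : Subset 10) → OddCutBound (lookup S)
  oddCutBound S = decidable-stable (bound? S) (from-no (anySubset? λ S → ¬? (bound? S)) ∘ (S ,_))
    where
    bound? : ∀ S → Dec (OddCutBound (lookup S))
    bound? S = (# (lookup S) % 2 ℕ.≟ 1) →-dec ((3 ≤? _) ×-dec all? λ k → 1 ≤? starCut (lookup S) k)

  -- Checked on all vertex sets. Behind it: an even cut has even size, hence at least 4 edges, and
  -- meets each matching evenly. If three matchings missed it, its edges would be among the three
  -- pairs of the other indices.
  evenCutBound : (S : Subset 10) → EvenCutBound (lookup S)
  evenCutBound S = decidable-stable (bound? S) (from-no (anySubset? λ S → ¬? (bound? S)) ∘ (S ,_))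
    where
    bound? : ∀ S → Dec (EvenCutBound (lookup S))
    bound? S = ¬? (# (lookup S) % 2 ℕ.≟ 1) →-dec any? (λ x → any? λ y → ¬? (lookup S x Bool.≟ lookup S y)) →-dec
      ((4 ≤? _) ×-dec any? λ e → all? λ k → 2 ≤? starCut (lookup S) k + 2 * star e k)

opaque
  -- Checked on all edge sets: the Petersen graph has no perfect matchings besides the six.
  perfectMatching-star : (S : Subset 15) → PerfectMatching (lookup S) → ∃ λ k → ∀ e → 𝟙 (lookup S e) ≡ star e k
  perfectMatching-star S = decidable-stable (star? S) (from-no (anySubset? λ S → ¬? (star? S)) ∘ (S ,_))
    where
    star? : (S : Subset 15) → Dec (PerfectMatching (lookup S) → ∃ λ k → ∀ e → 𝟙 (lookup S e) ≡ star e k)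
    star? S = all? (λ v → _ ℕ.≟ 1) →-dec any? λ k → all? λ e → 𝟙 (lookup S e) ℕ.≟ star e k

opaque
  pair-edge : ∀ k l → k ≢ l → ∃ λ e → (fst e ≡ k × snd e ≡ l) ⊎ (fst e ≡ l × snd e ≡ k)
  pair-edge = from-yes (all? λ k → all? λ l → ¬? (k ≟ l) →-dec
    any? λ e → (fst e ≟ k ×-dec snd e ≟ l) ⊎-dec (fst e ≟ l ×-dec snd e ≟ k))

  fst≢snd : ∀ e → fst e ≢ snd e
  fst≢snd = from-yes (all? λ e → ¬? (fst e ≟ snd e))

-- Weighted Petersen graphs P(c, a)

weight : ℕ → (Fin 6 → ℕ) → Fin 15 → ℕ
weight c a e = c + (a (fst e) + a (snd e))

∑-star : ∀ a e → ∑ (λ k → a k * star e k) ≡ a (fst e) + a (snd e)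
∑-star a e = begin
  ∑ (λ k → a k * star e k)
    ≡⟨ ∑-cong (λ k → trans (*-comm (a k) _) (*-distribʳ-+ (a k) (𝟙 ⌊ k ≟ fst e ⌋) (𝟙 ⌊ k ≟ snd e ⌋))) ⟩
  ∑ (λ k → 𝟙 ⌊ k ≟ fst e ⌋ * a k + 𝟙 ⌊ k ≟ snd e ⌋ * a k)
    ≡⟨ ∑-+ _ _ ⟩
  ∑ (λ k → 𝟙 ⌊ k ≟ fst e ⌋ * a k) + ∑ (λ k → 𝟙 ⌊ k ≟ snd e ⌋ * a k)
    ≡⟨ cong₂ _+_ (∑-δ (fst e) a) (∑-δ (snd e) a) ⟩
  a (fst e) + a (snd e) ∎
  where open ≡-Reasoning

-- The weighting consists of c copies of every edge and a_k further copies of each matching N_k;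
-- degrees and cuts split accordingly.
∑-weight : ∀ c a (g : Fin 15 → ℕ) →
  ∑ (λ e → weight c a e * g e) ≡ c * ∑ g + ∑ (λ k → a k * ∑ (λ e → star e k * g e))
∑-weight c a g = begin
  ∑ (λ e → weight c a e * g e)
    ≡⟨ ∑-cong (λ e → *-distribʳ-+ (g e) c (a (fst e) + a (snd e))) ⟩
  ∑ (λ e → c * g e + (a (fst e) + a (snd e)) * g e)
    ≡⟨ ∑-+ _ _ ⟩
  ∑ (λ e → c * g e) + ∑ (λ e → (a (fst e) + a (snd e)) * g e)
    ≡⟨ cong₂ _+_ (sym (∑-* c g)) (∑-cong λ e → cong (_* g e) (∑-star a e)) ⟨
  c * ∑ g + ∑ (λ e → ∑ (λ k → a k * star e k) * g e)
    ≡⟨ cong (c * ∑ g +_) (∑-cong λ e → trans (*-comm _ (g e)) (sym (∑-* (g e) _))) ⟩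
  c * ∑ g + ∑ (λ e → ∑ (λ k → g e * (a k * star e k)))
    ≡⟨ cong (c * ∑ g +_) (∑-swap _) ⟩
  c * ∑ g + ∑ (λ k → ∑ (λ e → g e * (a k * star e k)))
    ≡⟨ cong (c * ∑ g +_) (∑-cong λ k → trans
         (∑-cong λ e → trans (*-comm (g e) _) (*-assoc (a k) (star e k) (g e)))
         (∑-* (a k) _)) ⟩
  c * ∑ g + ∑ (λ k → a k * ∑ (λ e → star e k * g e)) ∎
  where open ≡-Reasoning

mix : ℕ → (Fin 6 → ℕ) → Graph
mix c a = blowup petersen (weight c a)

cut-mix : ∀ c a s → cut (mix c a) s ≡ c * ∑ (crossings s) + ∑ (λ k → a k * starCut s k)
cut-mix c a s = trans (∑-copyOf (weight c a) (crossings s)) (∑-weight c a (crossings s))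

module _ (s : Fin 10 → Bool) where

  private
    S = tabulate s
    S≗s : ∀ x → lookup S x ≡ s x
    S≗s = lookup∘tabulate s
    crossings≗ : ∀ e → crossings (lookup S) e ≡ crossings s e
    crossings≗ e = cong₂ (λ a b → 𝟙 (a xor b)) (S≗s _) (S≗s _)
    starCut≗ : ∀ k → starCut (lookup S) k ≡ starCut s k
    starCut≗ k = ∑-cong λ e → cong (star e k *_) (crossings≗ e)
    parity≗ : # (lookup S) % 2 ≡ # s % 2
    parity≗ = cong (_% 2) (#-cong S≗s)

  oddCut-bound : OddCutBound s
  oddCut-bound odd with oddCutBound S (trans parity≗ odd)
  ... | p , p′ = subst (3 ≤_) (∑-cong crossings≗) p , λ k → subst (1 ≤_) (starCut≗ k) (p′ k)

  evenCut-bound : EvenCutBound s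
  evenCut-bound even (x , y , sx≢sy)
    with evenCutBound S (even ∘ trans (sym parity≗)) (x , y , λ eq → sx≢sy (trans (sym (S≗s x)) (trans eq (S≗s y))))
  ... | p , e , p′ = subst (4 ≤_) (∑-cong crossings≗) p , e , λ k → subst (λ d → 2 ≤ d + 2 * star e k) (starCut≗ k) (p′ k)

-- Each N_k has one edge at every vertex and at least one in every odd cut; this gives degree r and
-- odd cuts of size at least 3c + ∑ a = r. For a nontrivial even set, let e = {i, j} name the exempt
-- matchings: the cut is at least 4c + 2(∑ a - a_i - a_j) = 2(r - `weight c a e`) ≥ 2q.
mix-good : ∀ {r q} c a → c * 3 + ∑ a ≡ r → (∀ e → q + weight c a e ≤ r) → q + q ≤ r → Good r q (mix c a)
mix-good {r} {q} c a total small 2q≤r = record { regular = reg ; oddCut = odd ; connected = conn }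
  where
  reg : ∀ v → # (incident (mix c a) v) ≡ r
  reg v = begin
    # (incident (mix c a) v)  ≡⟨ ∑-copyOf (weight c a) (λ e → 𝟙 (incident petersen v e)) ⟩
    ∑ (λ e → weight c a e * 𝟙 (incident petersen v e)) ≡⟨ ∑-weight c a _ ⟩
    c * # (incident petersen v) + ∑ (λ k → a k * ∑ (λ e → star e k * 𝟙 (incident petersen v e)))
      ≡⟨ cong₂ (λ d b → c * d + b) (petersen-cubic v)
           (∑-cong λ k → trans (cong (a k *_) (star-perfect v k)) (*-identityʳ (a k))) ⟩
    c * 3 + ∑ a               ≡⟨ total ⟩
    r ∎
    where open ≡-Reasoning

  odd : ∀ s → # s % 2 ≡ 1 → r ≤ cut (mix c a) s
  odd s p = begin
    r                            ≡⟨ total ⟨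
    c * 3 + ∑ a                  ≤⟨ +-mono-≤ (*-monoʳ-≤ c (proj₁ (oddCut-bound s p)))
                                      (∑-mono λ k → subst (_≤ a k * starCut s k) (*-identityʳ (a k))
                                        (*-monoʳ-≤ (a k) (proj₂ (oddCut-bound s p) k))) ⟩
    c * ∑ (crossings s) + ∑ (λ k → a k * starCut s k) ≡⟨ cut-mix c a s ⟨
    cut (mix c a) s ∎
    where open ≤-Reasoning

  conn : ∀ s x y → s x ≡ true → s y ≡ false → q + q ≤ cut (mix c a) s
  conn s x y sx sy with # s % 2 ℕ.≟ 1
  ... | yes p = ≤-trans 2q≤r (odd s p)
  ... | no ¬p with evenCut-bound s ¬p (x , y , λ eq → contradiction (trans (sym sx) (trans eq sy)) λ ())
  -- Twice the weight of `e` is added to both sides to avoid subtraction.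
  ...   | four , e , two = +-cancelʳ-≤ (2 * (c + (a (fst e) + a (snd e)))) _ _ (begin
    (q + q) + 2 * weight c a e                ≡⟨ solve 2 (λ q w → (q :+ q) :+ con 2 :* w := (q :+ w) :+ (q :+ w)) refl q (weight c a e) ⟩
    (q + weight c a e) + (q + weight c a e)   ≤⟨ +-mono-≤ (small e) (small e) ⟩
    r + r                                     ≡⟨ cong (λ t → t + t) total ⟨
    (c * 3 + ∑ a) + (c * 3 + ∑ a)             ≡⟨ solve 2 (λ c t → (c :* con 3 :+ t) :+ (c :* con 3 :+ t)
                                                   := c :* con 4 :+ con 2 :* t :+ con 2 :* c) refl c (∑ a) ⟩
    c * 4 + 2 * ∑ a + 2 * c                   ≤⟨ +-monoˡ-≤ (2 * c) (+-mono-≤ (*-monoʳ-≤ c four) stars) ⟩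
    c * ∑ (crossings s) + (T + 2 * p) + 2 * c ≡⟨ solve 4 (λ x t p c → x :+ (t :+ con 2 :* p) :+ con 2 :* c
                                                   := (x :+ t) :+ con 2 :* (c :+ p)) refl (c * ∑ (crossings s)) T p c ⟩
    (c * ∑ (crossings s) + T) + 2 * (c + p)   ≡⟨ cong (_+ 2 * (c + p)) (cut-mix c a s) ⟨
    cut (mix c a) s + 2 * weight c a e ∎)
    where
    open ≤-Reasoning
    open +-*-Solver
    T = ∑ λ k → a k * starCut s k
    p = a (fst e) + a (snd e)
    stars : 2 * ∑ a ≤ T + 2 * p
    stars = begin
      2 * ∑ a                                     ≡⟨ ∑-* 2 a ⟨
      ∑ (λ k → 2 * a k)                           ≤⟨ ∑-mono (λ k → subst (_≤ a k * (starCut s k + 2 * star e k)) (*-comm (a k) 2) (*-monoʳ-≤ (a k) (two k))) ⟩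
      ∑ (λ k → a k * (starCut s k + 2 * star e k)) ≡⟨ ∑-cong (λ k → solve 3 (λ a d t → a :* (d :+ con 2 :* t)
                                                        := a :* d :+ con 2 :* (a :* t)) refl (a k) (starCut s k) (star e k)) ⟩
      ∑ (λ k → a k * starCut s k + 2 * (a k * star e k)) ≡⟨ ∑-+ _ _ ⟩
      T + ∑ (λ k → 2 * (a k * star e k))          ≡⟨ cong (T +_) (trans (∑-* 2 _) (cong (2 *_) (∑-star a e))) ⟩
      T + 2 * p ∎

𝟙-≡ᵇ : ∀ {x} → x ≤ 1 → 𝟙 (x ℕ.≡ᵇ 1) ≡ x
𝟙-≡ᵇ {0} _ = refl
𝟙-≡ᵇ {1} _ = refl
𝟙-≡ᵇ {suc (suc _)} (s≤s ())

opaque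
  petersen-endpoint : ∀ e → ∃ λ v → incident petersen v e ≡ true
  petersen-endpoint = from-yes (all? λ e → any? λ v → incident petersen v e Bool.≟ true)

opaque
  unfolding ∑

  term≤∑ : (f : Fin n → ℕ) (i : Fin n) → f i ≤ ∑ f
  term≤∑ f zero    = m≤m+n _ _
  term≤∑ f (suc i) = ≤-trans (term≤∑ (f ∘ suc) i) (m≤n+m _ (f zero))

-- The usages of the three classes at a vertex sum to 1. Hence every usage is 0 or 1, and the used
-- classes form a perfect matching of the Petersen graph.
factor-star : ∀ {w} (M : Fin (∑ w) → Bool) → (∀ v → mdeg (blowup petersen w) M v ≡ 1) →
  ∃ λ k → ∀ e → # (λ x → M x ∧ class w e x) ≡ star e k
factor-star {w} M perfect = proj₁ found , λ e → trans (sym (bit-usage e)) (proj₂ found e)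
  where
  usage : Fin 15 → ℕ
  usage e = # (λ x → M x ∧ class w e x)
  S : Subset 15
  S = tabulate λ e → usage e ℕ.≡ᵇ 1
  vertexSum : ∀ v → ∑ (λ e → 𝟙 (incident petersen v e) * usage e) ≡ 1
  vertexSum v = trans (sym (mdeg-blowup petersen w M v)) (perfect v)
  usage≤1 : ∀ e → usage e ≤ 1
  usage≤1 e with petersen-endpoint e
  ... | v , inc = begin
    usage e                                       ≡⟨ *-identityˡ (usage e) ⟨
    1 * usage e                                   ≡⟨ cong (λ b → 𝟙 b * usage e) inc ⟨
    𝟙 (incident petersen v e) * usage e           ≤⟨ term≤∑ (λ e → 𝟙 (incident petersen v e) * usage e) e ⟩
    ∑ (λ e → 𝟙 (incident petersen v e) * usage e) ≡⟨ vertexSum v ⟩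
    1 ∎
    where open ≤-Reasoning
  bit-usage : ∀ e → 𝟙 (lookup S e) ≡ usage e
  bit-usage e = trans (cong 𝟙 (lookup∘tabulate (λ e → usage e ℕ.≡ᵇ 1) e)) (𝟙-≡ᵇ (usage≤1 e))
  matching : PerfectMatching (lookup S)
  matching v = begin
    sum₃ (𝟙 ∘ lookup S) (lookup edgesAt v)                    ≡⟨ ∑-at v _ ⟨
    ∑ (λ e → 𝟙 (incident petersen v e) * 𝟙 (lookup S e))      ≡⟨ ∑-cong (λ e → cong (𝟙 (incident petersen v e) *_) (bit-usage e)) ⟩
    ∑ (λ e → 𝟙 (incident petersen v e) * usage e)             ≡⟨ vertexSum v ⟩
    1 ∎
    where open ≡-Reasoning
  found : ∃ λ k → ∀ e → 𝟙 (lookup S e) ≡ star e k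
  found = perfectMatching-star S matching

opaque
  -- The witness counts the factors projecting to each N_k; class {i, j} is used once by each factor
  -- over N_i or N_j.
  packing-stars : ∀ {c a t} (P : Packing t (mix c a)) →
    ∃ λ (n : Fin 6 → ℕ) → ∑ n ≡ t × (∀ e → coverage P (class (weight c a) e) ≡ n (fst e) + n (snd e))
  packing-stars {c} {a} {t} P = count , total , λ e → trans (∑-cong (λ i → proj₂ (τ i) e)) (∑-+ _ _)
    where
    τ : ∀ i → ∃ λ k → ∀ e → # (λ x → factor P i x ∧ class (weight c a) e x) ≡ star e k
    τ i = factor-star (factor P i) (isFactor P i)
    count : Fin 6 → ℕ
    count k = # λ i → ⌊ proj₁ (τ i) ≟ k ⌋
    one : ∀ (j : Fin 6) → # (λ k → ⌊ j ≟ k ⌋) ≡ 1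
    one j = trans (∑-cong λ k → trans (cong 𝟙 (⌊≟⌋-sym j k)) (sym (*-identityʳ _))) (∑-δ j (λ _ → 1))
    total : ∑ count ≡ t
    total = begin
      ∑ count                                       ≡⟨ ∑-swap _ ⟩
      ∑ (λ i → # (λ k → ⌊ proj₁ (τ i) ≟ k ⌋))       ≡⟨ ∑-cong (λ i → one (proj₁ (τ i))) ⟩
      ∑ {t} (λ _ → 1)                               ≡⟨ ∑-one t ⟩
      t ∎
      where open ≡-Reasoning

edgewise⇒pairwise : ∀ (x y : Fin 6 → ℕ) → (∀ e → x (fst e) + x (snd e) ≤ suc (y (fst e) + y (snd e))) →
  ∀ i j → i ≢ j → x i + x j ≤ suc (y i + y j)
edgewise⇒pairwise x y edge i j i≢j with pair-edge i j i≢j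
... | e , inj₁ (refl , refl) = edge e
... | e , inj₂ (refl , refl) = subst₂ (λ a b → a ≤ suc b) (+-comm (x (fst e)) _) (+-comm (y (fst e)) _) (edge e)

-- The gadget

-- Among the indices 2, ..., 5 the n's exceed the a's by at most 1 in total. As ∑ n = r - 2 = 1 + ∑
-- a, this leaves n₀ + n₁ ≥ a₀ + a₁ = q - 1, all but one of the bundle.
absorber : ∀ {r q} a → 3 + ∑ a ≡ r → (∀ e → q + weight 1 a e ≤ r) → weight 1 a (spoke 0F) ≡ q → q + q ≤ r →
  Absorber r q (r ∸ 2)
absorber {r} {q} a total small size 2q≤r = record
  { gadget      = mix 1 a
  ; good        = mix-good 1 a total small 2q≤r
  ; half        = 5
  ; even        = refl
  ; terminal    = 0F
  ; bundle      = class (weight 1 a) (spoke 0F)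
  ; bundle-inc  = class-incident petersen (weight 1 a) {0F} {spoke 0F} refl
  ; bundle-size = trans (class-size (weight 1 a) (spoke 0F)) size
  ; spared      = λ P → subst (_≤ suc (coverage P (class (weight 1 a) (spoke 0F)))) (sym (class-size (weight 1 a) (spoke 0F)))
                    (s≤s (leaves P (packing-stars {1} {a} P)))
  }
  where
  leaves : (P : Packing (r ∸ 2) (mix 1 a)) →
    (∃ λ (n : Fin 6 → ℕ) → ∑ n ≡ r ∸ 2 × (∀ e → coverage P (class (weight 1 a) e) ≡ n (fst e) + n (snd e))) →
    a 0F + a 1F ≤ coverage P (class (weight 1 a) (spoke 0F))
  leaves P (n , ∑n , cov) = subst (a 0F + a 1F ≤_) (sym (cov (spoke 0F)))
    (+-cancelʳ-≤ (suc A) _ _ (begin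
      (a 0F + a 1F) + suc A     ≡⟨ +-suc (a 0F + a 1F) A ⟩
      suc ((a 0F + a 1F) + A)   ≡⟨ cong suc (split a) ⟨
      suc (∑ a)                 ≡⟨ cong (_∸ 2) total ⟩
      r ∸ 2                     ≡⟨ ∑n ⟨
      ∑ n                       ≡⟨ split n ⟩
      (n 0F + n 1F) + B         ≤⟨ +-monoʳ-≤ (n 0F + n 1F) (∑-pairwise 1 (λ i → n (suc (suc i))) (λ i → a (suc (suc i)))
                                     (λ i j i≢j → pair _ _ (i≢j ∘ Fin.suc-injective ∘ Fin.suc-injective))) ⟩
      (n 0F + n 1F) + suc A ∎))
    where
    open ≤-Reasoning
    A = ∑ λ (i : Fin 4) → a (suc (suc i))
    B = ∑ λ (i : Fin 4) → n (suc (suc i))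
    split : (f : Fin 6 → ℕ) → ∑ f ≡ (f 0F + f 1F) + ∑ λ (i : Fin 4) → f (suc (suc i))
    split f = trans (∑-suc f) (trans (cong (f 0F +_) (∑-suc _)) (sym (+-assoc (f 0F) (f 1F) _)))
    pair : ∀ i j → i ≢ j → n i + n j ≤ suc (a i + a j)
    pair = edgewise⇒pairwise n a λ e → subst₂ _≤_ (cov e) (class-size (weight 1 a) e) (coverage≤# P (class (weight 1 a) e))

-- The base graph and the counterexamples

-- Each edge of the two 5-cycles is assigned to one of its ends and each spoke to both. So every
-- vertex carries two classes, and two bundles of q edges fit there because 2q ≤ r.
demand₁ demand₂ : Fin 10 → Fin 15
demand₁ v = [ outer , inner ]′ (splitAt 5 v)
demand₂ v = [ spoke , spoke ]′ (splitAt 5 v)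

opaque
  demand-incident : ∀ v → incident petersen v (demand₁ v) ≡ true × incident petersen v (demand₂ v) ≡ true
  demand-incident = from-yes (all? λ v → (incident petersen v (demand₁ v) Bool.≟ true) ×-dec (incident petersen v (demand₂ v) Bool.≟ true))

  demand-distinct : ∀ v → demand₁ v ≢ demand₂ v
  demand-distinct = from-yes (all? λ v → ¬? (demand₁ v ≟ demand₂ v))

  demand-covers : ∀ e → ∃ λ v → demand₁ v ≡ e ⊎ demand₂ v ≡ e
  demand-covers = from-yes (all? λ e → any? λ v → (demand₁ v ≟ e) ⊎-dec (demand₂ v ≟ e))

module _ {r q} (a : Fin 6 → ℕ) (total : ∑ a ≡ r) (small : ∀ e → weight 0 a e ≤ q)
         (2q≤r : q + q ≤ r) (4≤r : 4 ≤ r) (A : Absorber r q (r ∸ 2)) where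

  open Grafting 2q≤r A

  private
    base = mix 0 a

    demand : Fin 10 → Demand q base
    demand v = record
      { vertex   = v
      ; R₁       = class (weight 0 a) (demand₁ v)
      ; R₂       = class (weight 0 a) (demand₂ v)
      ; inc₁     = class-incident petersen (weight 0 a) {v} {demand₁ v} (proj₁ (demand-incident v))
      ; inc₂     = class-incident petersen (weight 0 a) {v} {demand₂ v} (proj₂ (demand-incident v))
      ; disjoint = class-disjoint (weight 0 a) (demand-distinct v)
      ; size₁    = subst (_≤ q) (sym (class-size (weight 0 a) (demand₁ v))) (small (demand₁ v))
      ; size₂    = subst (_≤ q) (sym (class-size (weight 0 a) (demand₂ v))) (small (demand₂ v))
      }

    spared-class : (P : Packing (r ∸ 2) base) →
      (∀ v → Spared P (class (weight 0 a) (demand₁ v)) × Spared P (class (weight 0 a) (demand₂ v))) →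
      ∀ e → Spared P (class (weight 0 a) e)
    spared-class P spared e with demand-covers e
    ... | v , inj₁ eq = subst (λ e → Spared P (class (weight 0 a) e)) eq (proj₁ (spared v))
    ... | v , inj₂ eq = subst (λ e → Spared P (class (weight 0 a) e)) eq (proj₂ (spared v))

    -- Compared with the gadget, the roles in `∑-pairwise` are reversed: sizes a_i + a_j exceed
    -- usages by at most 1, so r = ∑ a ≤ 1 + (r - 2).
    not-all-spared : (P : Packing (r ∸ 2) base) → ¬ (∀ e → Spared P (class (weight 0 a) e))
    not-all-spared P spared with packing-stars {0} {a} P
    ... | ν , ∑ν , cov = <⇒≱ too-many (∑-pairwise 3 a ν (edgewise⇒pairwise a ν spared-edge))
      where
      open ≤-Reasoning
      too-many : suc (∑ ν) < ∑ a
      too-many = begin-strict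
        suc (∑ ν)     ≡⟨ cong suc ∑ν ⟩
        suc (r ∸ 2)   <⟨ ≤-reflexive (m+[n∸m]≡n (≤-trans (s≤s (s≤s z≤n)) 4≤r)) ⟩
        r             ≡⟨ total ⟨
        ∑ a ∎
      spared-edge : ∀ e → a (fst e) + a (snd e) ≤ suc (ν (fst e) + ν (snd e))
      spared-edge e = subst₂ (λ x y → x ≤ suc y) (class-size (weight 0 a) e) (cov e) (spared e)

  opaque
    counterexample : ∀ N → ∃ λ G → Good r q G × Fin (nV G) × ¬ Packing (r ∸ 2) G × N ≤ nV G
    counterexample N with satisfy 10 base (mix-good 0 a total (λ e → ≤-trans (+-monoʳ-≤ q (small e)) 2q≤r) 2q≤r) 0F demand (λ eq → eq)
    ... | G , good , x , project = grow N G good x (λ P → not-all-spared (proj₁ (project P)) (spared-class (proj₁ (project P)) (proj₂ (project P))))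

-- Translation to the notions of the theorem

toPacking : ∀ {k G} → HasDisjointOneFactors k G → Packing k G
toPacking {k} {G} (F , one , disjoint) = record
  { factor   = lookup ∘ F
  ; isFactor = λ i v → trans (sym (trans ∣ F i ∩ incEdges G v ∣≡#lookup
      (#-cong λ e → trans (lookup-zipWith _∧_ e (F i) (incEdges G v)) (cong (lookup (F i) e ∧_) (lookup∘tabulate (incident G v) e)))))
      (one i v)
  ; packed   = λ e → #≤1 _ λ i j p p′ → decidable-stable (i ≟ j) λ i≢j →
      disjoint i j i≢j e (lookup⇒[]= e (F i) p) (lookup⇒[]= e (F j) p′)
  }

module _ {r q G} (good : Good r q G) where

  private
    ∣boundary∣ : ∀ S → ∣ boundary G S ∣ ≡ cut G (lookup S)
    ∣boundary∣ S = ∣tabulate∣ _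

  good⇒IsRGraph : IsRGraph r G
  good⇒IsRGraph = (λ v → trans (∣tabulate∣ (incident G v)) (regular good v)) ,
    λ S odd → subst (r ≤_) (sym (∣boundary∣ S)) (oddCut good (lookup S) (trans (cong (_% 2) (sym ∣ S ∣≡#lookup)) odd))

  good⇒IsEdgeConnected : ∀ {t} → t ≤ q + q → IsEdgeConnected t G
  good⇒IsEdgeConnected t≤2q S 1≤∣S∣ ∣S∣<n with nonempty? S | nonempty? (∁ S)
  ... | yes (x , x∈S) | yes (y , y∈∁S) = ≤-trans t≤2q (subst (_ ≤_) (sym (∣boundary∣ S))
          (connected good (lookup S) x y ([]=⇒lookup x∈S) (Bool.not-injective (trans (sym (lookup-map y not S)) ([]=⇒lookup y∈∁S)))))
  ... | no S≡∅ | _ = contradiction (subst (1 ≤_) (trans (cong ∣_∣ (Empty-unique S≡∅)) (∣⊥∣≡0 (nV G))) 1≤∣S∣) λ ()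
  ... | _ | no ∁S≡∅ = contradiction ∣S∣<n (<⇒≱ (s≤s (≤-reflexive (sym full))))
    where
    full : ∣ S ∣ ≡ nV G
    full = ≤-antisym (∣p∣≤n S) (m∸n≡0⇒m≤n (trans (sym (∣∁p∣≡n∸∣p∣ S)) (trans (cong ∣_∣ (Empty-unique ∁S≡∅)) (∣⊥∣≡0 (nV G)))))

-- Multiplicities for every residue modulo 4

vec₆ : (a b c d e f : ℕ) → Fin 6 → ℕ
vec₆ a b c d e f = lookup (a ∷ b ∷ c ∷ d ∷ e ∷ f ∷ [])

opaque
  unfolding ∑

  ∑-vec₆ : ∀ a b c d e f → ∑ (vec₆ a b c d e f) ≡ a + (b + (c + (d + (e + (f + 0)))))
  ∑-vec₆ a b c d e f = refl

-- The two indices of an edge differ, so the exceptional index `p` occurs at most once.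
pair-bound : ∀ (a : Fin 6 → ℕ) p {A B} → B ≤ A → a p ≤ A → (∀ i → i ≢ p → a i ≤ B) →
  ∀ e → a (fst e) + a (snd e) ≤ A + B
pair-bound a p {A} {B} B≤A ap≤A a≤B e with fst e ≟ p | snd e ≟ p
... | yes refl | yes eq   = contradiction (sym eq) (fst≢snd e)
... | yes refl | no neq   = +-mono-≤ ap≤A (a≤B _ neq)
... | no neq   | yes refl = ≤-trans (+-mono-≤ (a≤B _ neq) ap≤A) (≤-reflexive (+-comm B A))
... | no neq   | no neq′  = +-mono-≤ (≤-trans (a≤B _ neq) B≤A) (a≤B _ neq′)

-- The α conditions are those of the base graph P(0, α), the β conditions those of the gadget P(1,
-- β) with bundle class {0, 1}.
record Parameters (r : ℕ) : Set where
  field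
    q       : ℕ
    tOf≤2q  : tOf r ≤ q + q
    2q≤r    : q + q ≤ r
    α β     : Fin 6 → ℕ
    ∑α      : ∑ α ≡ r
    α-small : ∀ e → α (fst e) + α (snd e) ≤ q
    ∑β      : 3 + ∑ β ≡ r
    β-small : ∀ e → q + suc (β (fst e) + β (snd e)) ≤ r
    β-pair  : suc (β 0F + β 1F) ≡ q

tOf-0 : ∀ r → r % 4 ≡ 0 → tOf r ≡ r
tOf-0 r eq with r % 4 | eq
... | _ | refl = refl

tOf-1 : ∀ r → r % 4 ≡ 1 → tOf r ≡ r ∸ 1
tOf-1 r eq with r % 4 | eq
... | _ | refl = refl

tOf-2 : ∀ r → r % 4 ≡ 2 → tOf r ≡ r ∸ 2
tOf-2 r eq with r % 4 | eq
... | _ | refl = refl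

tOf-3 : ∀ r → r % 4 ≡ 3 → tOf r ≡ r ∸ 1
tOf-3 r eq with r % 4 | eq
... | _ | refl = refl

4k : ∀ k → (k + k) + (k + k) ≡ k * 4
4k = solve 1 (λ k → (k :+ k) :+ (k :+ k) := k :* con 4) refl
  where open +-*-Solver

-- The multiplicities α of the base graph and β of the gadget, by residue of r mod 4.
parameters : ∀ c j → c < 4 → Parameters (c + suc j * 4)
parameters 0 j _ = record
  { q       = k + k
  ; tOf≤2q  = ≤-reflexive (trans (tOf-0 (k * 4) (m*n%n≡0 k 4)) (sym (4k k)))
  ; 2q≤r    = ≤-reflexive (4k k)
  ; α       = vec₆ k k k k 0 0
  -- `β-small` bounds pair sums by 2k - 1, so only one entry can reach k; it is placed at index 0,
  -- as `β-pair` asks for β₀ + β₁ = 2k - 1.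
  ; β       = vec₆ k j j j 0 0
  ; ∑α      = trans (∑-vec₆ k k k k 0 0)
                (solve 1 (λ k → k :+ (k :+ (k :+ (k :+ con 0))) := k :* con 4) refl k)
  ; α-small = pair-bound (vec₆ k k k k 0 0) 0F ≤-refl ≤-refl
                λ { 0F _ → ≤-refl ; 1F _ → ≤-refl ; 2F _ → ≤-refl ; 3F _ → ≤-refl ; 4F _ → z≤n ; 5F _ → z≤n }
  ; ∑β      = trans (cong (3 +_) (∑-vec₆ k j j j 0 0))
                (solve 1 (λ j → con 3 :+ ((con 1 :+ j) :+ (j :+ (j :+ (j :+ con 0)))) := (con 1 :+ j) :* con 4) refl j)
  ; β-small = λ e → ≤-trans (+-monoʳ-≤ (k + k) (s≤s (pair-bound (vec₆ k j j j 0 0) 0F (n≤1+n j) ≤-refl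
                (λ { 0F 0≢0 → contradiction refl 0≢0 ; 1F _ → ≤-refl ; 2F _ → ≤-refl ; 3F _ → ≤-refl ; 4F _ → z≤n ; 5F _ → z≤n }) e)))
                (≤-reflexive (solve 1 (λ j → let k = con 1 :+ j in (k :+ k) :+ (con 1 :+ (k :+ j)) := k :* con 4) refl j))
  ; β-pair  = sym (+-suc k j)
  }
  where
  open +-*-Solver
  k = suc j
parameters 1 j _ = record
  { q       = k + k
  ; tOf≤2q  = ≤-reflexive (trans (tOf-1 (1 + k * 4) ([m+kn]%n≡m%n 1 k 4)) (sym (4k k)))
  ; 2q≤r    = m≤n⇒m≤1+n (≤-reflexive (4k k))
  ; α       = vec₆ k k k k 1 0
  ; β       = vec₆ k j j k 0 0
  ; ∑α      = trans (∑-vec₆ k k k k 1 0)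
                (solve 1 (λ k → k :+ (k :+ (k :+ (k :+ con 1))) := con 1 :+ k :* con 4) refl k)
  ; α-small = pair-bound (vec₆ k k k k 1 0) 0F ≤-refl ≤-refl
                -- The entry 1 is at most k because r ≥ 4 makes k positive.
                λ { 0F _ → ≤-refl ; 1F _ → ≤-refl ; 2F _ → ≤-refl ; 3F _ → ≤-refl ; 4F _ → s≤s z≤n ; 5F _ → z≤n }
  ; ∑β      = trans (cong (3 +_) (∑-vec₆ k j j k 0 0))
                (solve 1 (λ j → con 3 :+ ((con 1 :+ j) :+ (j :+ (j :+ ((con 1 :+ j) :+ con 0)))) := con 1 :+ (con 1 :+ j) :* con 4) refl j)
  ; β-small = λ e → ≤-trans (+-monoʳ-≤ (k + k) (s≤s (pair-bound (vec₆ k j j k 0 0) 0F ≤-refl ≤-refl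
                (λ { 0F _ → ≤-refl ; 1F _ → n≤1+n j ; 2F _ → n≤1+n j ; 3F _ → ≤-refl ; 4F _ → z≤n ; 5F _ → z≤n }) e)))
                (≤-reflexive (solve 1 (λ k → (k :+ k) :+ (con 1 :+ (k :+ k)) := con 1 :+ k :* con 4) refl k))
  ; β-pair  = sym (+-suc k j)
  }
  where
  open +-*-Solver
  k = suc j
parameters 2 j _ = record
  { q       = k + k
  ; tOf≤2q  = ≤-reflexive (trans (tOf-2 (2 + k * 4) ([m+kn]%n≡m%n 2 k 4)) (sym (4k k)))
  ; 2q≤r    = m≤n⇒m≤1+n (m≤n⇒m≤1+n (≤-reflexive (4k k)))
  ; α       = vec₆ k k k k 1 1
  -- β₀ + β₁ is fixed at q - 1, so the surplus goes to index 3; pair sums may now reach 2k + 1.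
  ; β       = vec₆ k j j (suc k) 0 0
  ; ∑α      = trans (∑-vec₆ k k k k 1 1)
                (solve 1 (λ k → k :+ (k :+ (k :+ (k :+ con 2))) := con 2 :+ k :* con 4) refl k)
  ; α-small = pair-bound (vec₆ k k k k 1 1) 0F ≤-refl ≤-refl
                λ { 0F _ → ≤-refl ; 1F _ → ≤-refl ; 2F _ → ≤-refl ; 3F _ → ≤-refl ; 4F _ → s≤s z≤n ; 5F _ → s≤s z≤n }
  ; ∑β      = trans (cong (3 +_) (∑-vec₆ k j j (suc k) 0 0))
                (solve 1 (λ j → con 3 :+ ((con 1 :+ j) :+ (j :+ (j :+ ((con 2 :+ j) :+ con 0)))) := con 2 :+ (con 1 :+ j) :* con 4) refl j)
  ; β-small = λ e → ≤-trans (+-monoʳ-≤ (k + k) (s≤s (pair-bound (vec₆ k j j (suc k) 0 0) 3F (n≤1+n k) ≤-refl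
                (λ { 0F _ → ≤-refl ; 1F _ → n≤1+n j ; 2F _ → n≤1+n j ; 3F 3≢3 → contradiction refl 3≢3 ; 4F _ → z≤n ; 5F _ → z≤n }) e)))
                (≤-reflexive (solve 1 (λ k → (k :+ k) :+ (con 1 :+ ((con 1 :+ k) :+ k)) := con 2 :+ k :* con 4) refl k))
  ; β-pair  = sym (+-suc k j)
  }
  where
  open +-*-Solver
  k = suc j
parameters 3 j _ = record
  { q       = suc (k + k)
  ; tOf≤2q  = ≤-reflexive (trans (tOf-3 (3 + k * 4) ([m+kn]%n≡m%n 3 k 4)) (sym 4k+2))
  ; 2q≤r    = m≤n⇒m≤1+n (≤-reflexive 4k+2)
  ; α       = vec₆ (suc k) k k k 1 1
  ; β       = vec₆ k k k k 0 0
  ; ∑α      = trans (∑-vec₆ (suc k) k k k 1 1)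
                (solve 1 (λ k → (con 1 :+ k) :+ (k :+ (k :+ (k :+ con 2))) := con 3 :+ k :* con 4) refl k)
  ; α-small = pair-bound (vec₆ (suc k) k k k 1 1) 0F (n≤1+n k) ≤-refl
                λ { 0F 0≢0 → contradiction refl 0≢0 ; 1F _ → ≤-refl ; 2F _ → ≤-refl ; 3F _ → ≤-refl ; 4F _ → s≤s z≤n ; 5F _ → s≤s z≤n }
  ; ∑β      = trans (cong (3 +_) (∑-vec₆ k k k k 0 0))
                (solve 1 (λ k → con 3 :+ (k :+ (k :+ (k :+ (k :+ con 0)))) := con 3 :+ k :* con 4) refl k)
  ; β-small = λ e → ≤-trans (+-monoʳ-≤ (suc (k + k)) (s≤s (pair-bound (vec₆ k k k k 0 0) 0F ≤-refl ≤-refl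
                (λ { 0F _ → ≤-refl ; 1F _ → ≤-refl ; 2F _ → ≤-refl ; 3F _ → ≤-refl ; 4F _ → z≤n ; 5F _ → z≤n }) e)))
                (m≤n⇒m≤1+n (≤-reflexive (solve 1 (λ k → (con 1 :+ (k :+ k)) :+ (con 1 :+ (k :+ k)) := con 2 :+ k :* con 4) refl k)))
  ; β-pair  = refl
  }
  where
  open +-*-Solver
  k = suc j
  4k+2 : suc (k + k) + suc (k + k) ≡ 2 + k * 4
  4k+2 = solve 1 (λ k → (con 1 :+ (k :+ k)) :+ (con 1 :+ (k :+ k)) := con 2 :+ k :* con 4) refl k
parameters (suc (suc (suc (suc _)))) j (s≤s (s≤s (s≤s (s≤s ()))))

parametersFor : ∀ r → 4 ≤ r → Parameters r
parametersFor r 4≤r with r / 4 | m≡m%n+[m/n]*n r 4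
... | suc j | eq = subst Parameters (sym eq) (parameters (r % 4) j (m%n<n r 4))
... | zero  | eq = contradiction 4≤r (<⇒≱ (subst (_< 4) (trans (sym (+-identityʳ _)) (sym eq)) (m%n<n r 4)))

-- Infinitely many graphs are obtained as graphs of unbounded order, one for each lower bound `N`.
theorem1p1 : (r : ℕ) → 4 ≤ r → (N : ℕ) →
    Σ Graph (λ G → N ≤ nV G × IsRGraph r G × IsEdgeConnected (tOf r) G ×
    ¬ HasDisjointOneFactors (r ∸ 2) G)
theorem1p1 r 4≤r N =
  let
    open Parameters (parametersFor r 4≤r)
    G , good , _ , noPacking , N≤nV = counterexample α ∑α α-small 2q≤r 4≤r (absorber β ∑β β-small β-pair 2q≤r) N
  in G , N≤nV , good⇒IsRGraph good , good⇒IsEdgeConnected good tOf≤2q , noPacking ∘ toPacking
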